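{- Let $R$ be a finite commutative ring with unity $1\neq 0$, and write $R\cong R_1\times\cdots\times R_s$ ($s\ge 1$), where each $R_i$ is a finite local ring with unique maximal ideal $M_i$, the factors being ordered so that $|R_1|/|M_1|\geq \cdots\geq |R_s|/|M_s|$. Then the unitary Cayley graph $G_R$ is periodic if and only if either $R_1/M_1\cong \mathbb{Z}_2$ or $R_1/M_1\cong\mathbb{Z}_3$, and $R_i/M_i\cong\mathbb{Z}_2$ for all $i\in\{2,\ldots,s\}$.
   Context: Every finite commutative ring with unity decomposes (uniquely up to order) as a direct product of finite local rings. $R^\times$ denotes the group of units of $R$. The unitary Cayley graph $G_R=\operatorname{Cay}(R,R^\times)$ has vertex set $R$, with distinct vertices $u,v$ adjacent iff $u-v\in R^\times$. Grover walk on a finite simple graph $G$ without isolated vertices: let $\mathcal{A}(G)=\{(u,v),(v,u): uv\in E(G)\}$ be the set of arcs; for $a=(u,v)$ put $t(a)=v$ and $a^{ -1}=(v,u)$. The boundary matrix $N\in\mathbb{C}^{V(G)\times\mathcal{A}(G)}$ is $N_{ua}=\frac{1}{\sqrt{\deg u}}\delta_{u,t(a)}$, the shift matrix $S\in\mathbb{C}^{\mathcal{A}(G)\times\mathcal{A}(G)}$ is $S_{ab}=\delta_{a,b^{ -1}}$, and the time evolution matrix is $U=S(2N^*N-I)$. The graph $G$ is called periodic if $U^\tau=I$ for some positive integer $\tau$. -}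

module Defs where

open import Level using (0ℓ)
open import Algebra.Bundles using (CommutativeRing)
open import Data.Bool using (Bool; true; false; if_then_else_; _∧_; not)
open import Data.Nat using (ℕ; zero; suc; _<_; _≤_; NonZero)
open import Data.Nat.DivMod using (_/_; _%_)
open import Data.Fin using (Fin; toℕ)
open import Data.List using (List; []; _∷_; length; map; concatMap)
open import Data.List.Relation.Unary.Any using (Any)
open import Data.List.Relation.Unary.AllPairs using (AllPairs)
open import Data.List.Membership.Propositional using (_∈_)
open import Data.Product using (Σ; _×_; _,_; ∃)
open import Data.Sum using (_⊎_)
open import Data.Integer using (+_)
open import Data.Rational as ℚ using (ℚ; 0ℚ; 1ℚ)
open import Relation.Nullary using (¬_; does)
open import Relation.Binary using (Decidable)
open import Relation.Binary.PropositionalEquality using (_≡_)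
open import Function.Bundles using (_⇔_)

record FiniteCommRing : Set₁ where
  field
    commRing : CommutativeRing 0ℓ 0ℓ
  open CommutativeRing commRing public
  field
    _≟_        : Decidable _≈_
    elems      : List Carrier
    complete   : ∀ x → Any (x ≈_) elems
    unique     : AllPairs (λ x y → ¬ (x ≈ y)) elems
    nontrivial : ¬ (1# ≈ 0#)

  card : ℕ
  card = length elems

  countIn : (Carrier → Bool) → ℕ
  countIn P = go elems
    where
    go : List Carrier → ℕ
    go []       = 0
    go (x ∷ xs) = if P x then suc (go xs) else go xs

  record IsIdeal (I : Carrier → Bool) : Set where
    field
      resp   : ∀ {x y} → x ≈ y → I x ≡ I y
      zero∈  : I 0# ≡ true
      +-cl   : ∀ x y → I x ≡ true → I y ≡ true → I (x + y) ≡ true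
      *-cl   : ∀ r x → I x ≡ true → I (r * x) ≡ true

  record IsMaximalIdeal (M : Carrier → Bool) : Set₁ where
    field
      ideal  : IsIdeal M
      proper : M 1# ≡ false
      maxl   : ∀ (J : Carrier → Bool) → IsIdeal J →
               (∀ x → M x ≡ true → J x ≡ true) →
               (∀ x → J x ≡ M x) ⊎ (J 1# ≡ true)

  IsUniqueMaximalIdeal : (Carrier → Bool) → Set₁
  IsUniqueMaximalIdeal M =
    IsMaximalIdeal M × (∀ M' → IsMaximalIdeal M' → ∀ x → M' x ≡ M x)

  -- |R| / |M|  (M contains 0, so |M| ≥ 1; the zero case is a dummy)
  residueSize : (Carrier → Bool) → ℕ
  residueSize M with countIn M
  ... | zero  = 0
  ... | suc m = card / suc m

  -- R / M ≅ ℤ_m.  The quotient R/M is the setoid quotient of R by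
  -- x ~ y ⇔ x - y ∈ M; ℤ_m is modelled as {0,…,m-1} with arithmetic
  -- mod m.  A ring isomorphism R/M → ℤ_m is a map f : R → ℤ_m that is
  -- well defined and injective on classes (f x ≡ f y ⇔ x - y ∈ M),
  -- surjective, and preserves +, * and 1.

  record ResidueIso (M : Carrier → Bool) (m : ℕ) .{{_ : NonZero m}} : Set where
    field
      f       : Carrier → ℕ
      f<m     : ∀ x → f x < m
      classes : ∀ x y → (f x ≡ f y) ⇔ (M (x - y) ≡ true)
      surj    : ∀ k → k < m → ∃ λ x → f x ≡ k
      hom-+   : ∀ x y → f (x + y) ≡ (f x Data.Nat.+ f y) % m
      hom-*   : ∀ x y → f (x * y) ≡ (f x Data.Nat.* f y) % m
      hom-1   : f 1# ≡ 1 % m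

  isUnit : Carrier → Bool
  isUnit x = anyL elems
    where
    anyL : List Carrier → Bool
    anyL []       = false
    anyL (w ∷ ws) = if does ((x * w) ≟ 1#) then true else anyL ws

  eqB : Carrier → Carrier → Bool
  eqB u v = does (u ≟ v)

  adj : Carrier → Carrier → Bool
  adj u v = not (eqB u v) ∧ isUnit (u - v)

  filterB : (Carrier → Bool) → List Carrier → List Carrier
  filterB P []       = []
  filterB P (x ∷ xs) = if P x then x ∷ filterB P xs else filterB P xs

  deg : Carrier → ℕ
  deg u = length (filterB (adj u) elems)

  Arc : Set
  Arc = Carrier × Carrier

  -- the arc set 𝒜(G_R), one representative per arc
  arcs : List Arc
  arcs = concatMap (λ u → map (λ v → (u , v)) (filterB (adj u) elems)) elems

  t : Arc → Carrier
  t (u , v) = v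

  _⁻¹ᵃ : Arc → Arc
  (u , v) ⁻¹ᵃ = (v , u)

  eqArc : Arc → Arc → Bool
  eqArc (a₁ , a₂) (b₁ , b₂) = eqB a₁ b₁ ∧ eqB a₂ b₂

  Mat : Set
  Mat = Arc → Arc → ℚ

  δ : Bool → ℚ
  δ true  = 1ℚ
  δ false = 0ℚ

  sumℚ : List ℚ → ℚ
  sumℚ []       = 0ℚ
  sumℚ (q ∷ qs) = q ℚ.+ sumℚ qs

  _·_ : Mat → Mat → Mat
  (A · B) a b = sumℚ (map (λ c → A a c ℚ.* B c b) arcs)

  I : Mat
  I a b = δ (eqArc a b)

  _^_ : Mat → ℕ → Mat
  A ^ zero  = I
  A ^ suc n = A · (A ^ n)

  -- k / d in ℚ (d = 0 never occurs for degrees in G_R; dummy value 0)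
  fracℚ : ℕ → ℕ → ℚ
  fracℚ k zero    = 0ℚ
  fracℚ k (suc d) = (+ k) ℚ./ suc d

  -- N*N : (N*N)_{ab} = Σ_u N_{ua} N_{ub} = δ_{t(a),t(b)} / deg t(a)
  -- (entries of N are 1/√deg; their products are rational)
  NstarN : Mat
  NstarN a b = δ (eqB (t a) (t b)) ℚ.* fracℚ 1 (deg (t a))

  S : Mat
  S a b = δ (eqArc a (b ⁻¹ᵃ))

  C : Mat
  C a b = ((+ 2) ℚ./ 1) ℚ.* NstarN a b ℚ.- I a b

  U : Mat
  U = S · C

  Periodic : Set
  Periodic = Σ ℕ λ τ → (1 ≤ τ) × (∀ a b → a ∈ arcs → b ∈ arcs → (U ^ τ) a b ≡ I a b)

record ProductIso (R : FiniteCommRing) {s : ℕ} (Rs : Fin s → FiniteCommRing) : Set where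
  module R = FiniteCommRing R
  module Rᵢ (i : Fin s) = FiniteCommRing (Rs i)
  field
    φ      : R.Carrier → (i : Fin s) → Rᵢ.Carrier i
    cong   : ∀ {x y} → x R.≈ y → ∀ i → Rᵢ._≈_ i (φ x i) (φ y i)
    hom-+  : ∀ x y i → Rᵢ._≈_ i (φ (x R.+ y) i) (Rᵢ._+_ i (φ x i) (φ y i))
    hom-*  : ∀ x y i → Rᵢ._≈_ i (φ (x R.* y) i) (Rᵢ._*_ i (φ x i) (φ y i))
    hom-1  : ∀ i → Rᵢ._≈_ i (φ R.1# i) (Rᵢ.1# i)
    inj    : ∀ x y → (∀ i → Rᵢ._≈_ i (φ x i) (φ y i)) → x R.≈ y
    surj   : ∀ (g : (i : Fin s) → Rᵢ.Carrier i) → ∃ λ x → ∀ i → Rᵢ._≈_ i (φ x i) (g i)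

{-# OPTIONS --safe #-}
module Submission where

-- The walk acts on arc functions by (U g)(x,y) = 2/d Σ_{w~x} g(w,x) − g(y,x).
--
-- If the residue fields are as stated and J is the Jacobson radical, the units are the cosets
-- ±1 + J and 6 ∈ J, so G_R is a blow-up of a cycle of length 2, 3 or 6.  Split an arc function into
-- its average over the cosets of J × J and the rest: the average is merely rotated around the cycle,
-- so U⁶ fixes it, while U⁴ fixes the rest.  Hence U¹² = I.
--
-- Conversely, let m_i = |M_i| and n_i = |R_i|.  The function ∏_i (n_i [x_i ∈ M_i] − m_i) is an
-- eigenfunction of the adjacency operator with eigenvalue ∏ (−m_i), whereas d = ∏ (n_i − m_i).
-- On its lift to arcs U acts through the Chebyshev recurrence with θ = 2 ∏ (−m_i) / ∏ (n_i − m_i),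
-- and U^τ = I forces θ = ±2 or makes the rational number θ a zero of a monic integral polynomial, so an integer.
-- Either way ∏ (n_i − m_i) ≤ 2 ∏ m_i, which leaves n_i = 2 m_i for all factors but at most one,
-- where n_i = 3 m_i.

open import Defs
open import Data.Bool as Bool using (Bool; true; false; _∧_; _∨_; not; if_then_else_)
open import Data.Bool.Properties using (⇔→≡; ¬-not)
open import Data.Fin as Fin using (Fin; toℕ; zero; suc)
open import Data.Fin.Properties using (all?)
import Data.Integer as ℤ
import Data.Integer.Properties as ℤₚ
open import Data.List using (List; []; _∷_; _++_; map; concatMap; length)
open import Data.List.Membership.Propositional using (_∈_; lose; find)
open import Data.List.Membership.Propositional.Properties using (∈-map⁺; ∈-map⁻; ∈-concatMap⁺; ∈-concatMap⁻)
open import Data.List.Relation.Unary.All as All using (All; []; _∷_)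
open import Data.List.Relation.Unary.AllPairs using (AllPairs; []; _∷_)
open import Data.List.Relation.Unary.Any as Any using (Any; here; there)
open import Data.Nat as ℕ using (ℕ; zero; suc; _≤_; s≤s; z≤n)
open import Data.Nat.Coprimality as Coprimality using (Coprime; coprime-/gcd; coprime-divisor)
open import Data.Nat.DivMod using (m/n*n≡m; m*n/n≡m; m%n<n; m≡m%n+[m/n]*n)
open import Data.Nat.Divisibility using (_∣_; ∣⇒≤; ∣1⇒≡1; ∣m+n∣m⇒∣n; m∣m*n)
open import Data.Nat.GCD using (gcd; gcd[m,n]∣m; gcd[m,n]∣n; gcd[m,n]≡0⇒m≡0)
import Data.Nat.Properties as ℕₚ
open import Data.Nat.Tactic.RingSolver using (solve-∀)
open import Data.Product using (_×_; _,_; ∃; proj₁; proj₂)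
open import Data.Rational using (ℚ; 0ℚ; 1ℚ; _+_; _*_; _-_; -_; _/_)
import Data.Rational as ℚ
import Data.Rational.Properties as ℚₚ
open import Data.Rational.Solver using (module +-*-Solver)
import Data.Rational.Unnormalised as ℚᵘ
import Data.Rational.Unnormalised.Properties as ℚᵘₚ
open import Data.Sum using (_⊎_; inj₁; inj₂)
open import Function.Bundles using (_⇔_; mk⇔; Equivalence)
open import Relation.Binary.PropositionalEquality hiding (resp; J)
open import Relation.Nullary using (¬_; contradiction; does; yes; no; Dec)
open import Relation.Nullary.Decidable using (dec-true; dec-false)
open +-*-Solver using (solve; _:=_; _:+_; _:*_; _:-_; :-_; con)

-- Finite sums of rationals

-- Every eigenvalue of the adjacency operator constrains a periodic walk. The eigenfunction that is
-- nonconstant in all factors is chosen because its |θ| = 2 / ∏ (|R_i/M_i| - 1) is the smallest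
-- nonzero one, so that integrality of θ says the most: a nonzero integer has absolute value at
-- least 1, which is the bound on the product. Scaling it to integer values keeps the argument
-- inside ℚ; no complex eigenvalue of U ever appears. The obstacle is that `U^τ = I` cannot simply
-- be compared coefficient by coefficient: the tail and head lifts of the eigenfunction may be
-- linearly dependent on arcs, as happens for θ = ±2. The factor 4 - θ² carried next to the
-- Chebyshev value absorbs this case. In the other direction a vertex sees just two neighbouring
-- cosets, and a Grover coin of degree two transmits without reflecting; this is why the averaged
-- part only rotates. On the remaining part the coset means vanish, and two successive steps change
-- a function only by terms that the next two steps cancel. Since R is a setoid and `arcs` lists one
-- pair per class, arc functions are required to respect ≈ and are compared on adjacent pairs only.

private variable
  A B : Set

2ℚ : ℚ
2ℚ = 1ℚ + 1ℚ

ind : Bool → ℚ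
ind true  = 1ℚ
ind false = 0ℚ

ind-∧ : ∀ a b → ind (a ∧ b) ≡ ind a * ind b
ind-∧ true  b = sym (ℚₚ.*-identityˡ (ind b))
ind-∧ false b = sym (ℚₚ.*-zeroˡ (ind b))

ind-not : ∀ b → ind (not b) ≡ 1ℚ - ind b
ind-not true  = refl
ind-not false = refl

ind-*-cong : ∀ b {p q} → (b ≡ true → p ≡ q) → ind b * p ≡ ind b * q
ind-*-cong true          h = cong (1ℚ *_) (h refl)
ind-*-cong false {p} {q} h = trans (ℚₚ.*-zeroˡ p) (sym (ℚₚ.*-zeroˡ q))

-- Recursive rather than `(+ n) / 1`, so that counting sums of 1ℚ and inductions on n unfold; `ι≡/1`
-- and `1/suc*ι` connect it with `fracℚ`.
ι : ℕ → ℚ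
ι zero    = 0ℚ
ι (suc n) = 1ℚ + ι n

ι-+ : ∀ m n → ι (m ℕ.+ n) ≡ ι m + ι n
ι-+ zero    n = sym (ℚₚ.+-identityˡ (ι n))
ι-+ (suc m) n = trans (cong (1ℚ ℚ.+_) (ι-+ m n)) (sym (ℚₚ.+-assoc 1ℚ (ι m) (ι n)))

ι-* : ∀ m n → ι (m ℕ.* n) ≡ ι m * ι n
ι-* zero    n = sym (ℚₚ.*-zeroˡ (ι n))
ι-* (suc m) n = begin
  ι (n ℕ.+ m ℕ.* n)        ≡⟨ ι-+ n (m ℕ.* n) ⟩
  ι n + ι (m ℕ.* n)        ≡⟨ cong (ι n +_) (ι-* m n) ⟩
  ι n + ι m * ι n          ≡⟨ solve 2 (λ a b → b :+ a :* b := (con 1ℚ :+ a) :* b) refl (ι m) (ι n) ⟩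
  (1ℚ + ι m) * ι n         ∎
  where open ≡-Reasoning

0≤ι : ∀ n → 0ℚ ℚ.≤ ι n
0≤ι zero    = ℚₚ.≤-refl
0≤ι (suc n) = ℚₚ.+-mono-≤ (ℚₚ.<⇒≤ (ℚₚ.positive⁻¹ 1ℚ)) (0≤ι n)

0<ι-suc : ∀ n → 0ℚ ℚ.< ι (suc n)
0<ι-suc n = ℚₚ.+-mono-<-≤ (ℚₚ.positive⁻¹ 1ℚ) (0≤ι n)

ι-cancel-≤ : ∀ m n → ι m ℚ.≤ ι n → m ℕ.≤ n
ι-cancel-≤ zero    n       le = ℕ.z≤n
ι-cancel-≤ (suc m) zero    le = contradiction (ℚₚ.<-≤-trans (0<ι-suc m) le) (ℚₚ.<-irrefl refl)
ι-cancel-≤ (suc m) (suc n) le = ℕ.s≤s (ι-cancel-≤ m n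
  (subst₂ ℚ._≤_ (drop-1 (ι m)) (drop-1 (ι n)) (ℚₚ.+-monoʳ-≤ (- 1ℚ) le)))
  where
  drop-1 : ∀ p → - 1ℚ + (1ℚ + p) ≡ p
  drop-1 = solve 1 (λ p → :- con 1ℚ :+ (con 1ℚ :+ p) := p) refl

ι-injective : ∀ m n → ι m ≡ ι n → m ≡ n
ι-injective m n eq =
  ℕₚ.≤-antisym (ι-cancel-≤ m n (ℚₚ.≤-reflexive eq)) (ι-cancel-≤ n m (ℚₚ.≤-reflexive (sym eq)))

ι≢0 : ∀ n → n ≢ 0 → ι n ≢ 0ℚ
ι≢0 n n≢0 eq = n≢0 (ι-injective n 0 eq)

ι≡/1 : ∀ n → ι n ≡ (ℤ.+ n) / 1
ι≡/1 zero    = refl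
ι≡/1 (suc n) = trans (cong (1ℚ +_) (ι≡/1 n)) (ℚₚ.toℚᵘ-injective (begin
  ℚ.toℚᵘ (1ℚ + (ℤ.+ n) / 1)                          ≈⟨ ℚₚ.toℚᵘ-homo-+ 1ℚ ((ℤ.+ n) / 1) ⟩
  ℚᵘ.1ℚᵘ ℚᵘ.+ ℚ.toℚᵘ ((ℤ.+ n) / 1)                   ≈⟨ ℚᵘₚ.+-congʳ ℚᵘ.1ℚᵘ (ℚₚ.toℚᵘ-fromℚᵘ (ℚᵘ.mkℚᵘ (ℤ.+ n) 0)) ⟩
  ℚᵘ.1ℚᵘ ℚᵘ.+ ℚᵘ.mkℚᵘ (ℤ.+ n) 0                      ≈⟨ ℚᵘ.*≡* (cong (λ z → ((ℤ.+ 1) ℤ.+ z) ℤ.* (ℤ.+ 1)) (ℤₚ.*-identityʳ (ℤ.+ n))) ⟩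
  ℚᵘ.mkℚᵘ (ℤ.+ suc n) 0                              ≈⟨ ℚᵘₚ.≃-sym (ℚₚ.toℚᵘ-fromℚᵘ (ℚᵘ.mkℚᵘ (ℤ.+ suc n) 0)) ⟩
  ℚ.toℚᵘ ((ℤ.+ suc n) / 1)                           ∎))
  where open ℚᵘₚ.≃-Reasoning

1/suc*ι : ∀ d → ((ℤ.+ 1) / suc d) * ι (suc d) ≡ 1ℚ
1/suc*ι d = trans (cong (((ℤ.+ 1) / suc d) *_) (ι≡/1 (suc d))) (ℚₚ.toℚᵘ-injective (begin
  ℚ.toℚᵘ (((ℤ.+ 1) / suc d) * ((ℤ.+ suc d) / 1))              ≈⟨ ℚₚ.toℚᵘ-homo-* ((ℤ.+ 1) / suc d) ((ℤ.+ suc d) / 1) ⟩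
  ℚ.toℚᵘ ((ℤ.+ 1) / suc d) ℚᵘ.* ℚ.toℚᵘ ((ℤ.+ suc d) / 1)      ≈⟨ ℚᵘₚ.*-cong (ℚₚ.toℚᵘ-fromℚᵘ (ℚᵘ.mkℚᵘ (ℤ.+ 1) d)) (ℚₚ.toℚᵘ-fromℚᵘ (ℚᵘ.mkℚᵘ (ℤ.+ suc d) 0)) ⟩
  ℚᵘ.mkℚᵘ (ℤ.+ 1) d ℚᵘ.* ℚᵘ.mkℚᵘ (ℤ.+ suc d) 0                ≈⟨ ℚᵘ.*≡* (cong ℤ.+_ (trans (ℕₚ.*-identityʳ (1 ℕ.* suc d)) (sym (cong (1 ℕ.*_) (ℕₚ.*-identityʳ (suc d)))))) ⟩
  ℚᵘ.1ℚᵘ                                                  ∎))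
  where open ℚᵘₚ.≃-Reasoning

*-cancelˡ-≡0 : ∀ p {q} → p ≢ 0ℚ → p * q ≡ 0ℚ → q ≡ 0ℚ
*-cancelˡ-≡0 p {q} p≢0 eq = begin
  q                    ≡⟨ ℚₚ.*-identityˡ q ⟨
  1ℚ * q               ≡⟨ cong (_* q) (ℚₚ.*-inverseˡ p) ⟨
  (ℚ.1/ p * p) * q     ≡⟨ ℚₚ.*-assoc (ℚ.1/ p) p q ⟩
  ℚ.1/ p * (p * q)     ≡⟨ cong (ℚ.1/ p *_) eq ⟩
  ℚ.1/ p * 0ℚ          ≡⟨ ℚₚ.*-zeroʳ (ℚ.1/ p) ⟩
  0ℚ                   ∎
  where
  open ≡-Reasoning
  instance _ = ℚ.≢-nonZero p≢0

∑ : List A → (A → ℚ) → ℚ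
∑ []       f = 0ℚ
∑ (x ∷ xs) f = f x + ∑ xs f

infix 6 ∑-syntax
∑-syntax : List A → (A → ℚ) → ℚ
∑-syntax = ∑
syntax ∑-syntax xs (λ x → e) = ∑[ x ← xs ] e

∑-cong-∈ : ∀ (xs : List A) {f g : A → ℚ} → (∀ x → x ∈ xs → f x ≡ g x) → ∑ xs f ≡ ∑ xs g
∑-cong-∈ []       h = refl
∑-cong-∈ (x ∷ xs) h = cong₂ _+_ (h x (here refl)) (∑-cong-∈ xs (λ y y∈ → h y (there y∈)))

∑-cong : ∀ (xs : List A) {f g : A → ℚ} → (∀ x → f x ≡ g x) → ∑ xs f ≡ ∑ xs g
∑-cong xs h = ∑-cong-∈ xs (λ x _ → h x)

∑-zero : ∀ (xs : List A) → ∑[ x ← xs ] 0ℚ ≡ 0ℚ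
∑-zero []       = refl
∑-zero (x ∷ xs) = trans (ℚₚ.+-identityˡ _) (∑-zero xs)

∑-+ : ∀ (xs : List A) (f g : A → ℚ) → ∑[ x ← xs ] (f x + g x) ≡ ∑ xs f + ∑ xs g
∑-+ []       f g = refl
∑-+ (x ∷ xs) f g = trans (cong ((f x + g x) +_) (∑-+ xs f g))
  (solve 4 (λ a b c d → (a :+ b) :+ (c :+ d) := (a :+ c) :+ (b :+ d)) refl (f x) (g x) (∑ xs f) (∑ xs g))

∑-*ˡ : ∀ (xs : List A) p (f : A → ℚ) → ∑[ x ← xs ] (p * f x) ≡ p * ∑ xs f
∑-*ˡ []       p f = sym (ℚₚ.*-zeroʳ p)
∑-*ˡ (x ∷ xs) p f = trans (cong (p * f x +_) (∑-*ˡ xs p f)) (sym (ℚₚ.*-distribˡ-+ p (f x) (∑ xs f)))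

∑-*ʳ : ∀ (xs : List A) p (f : A → ℚ) → ∑[ x ← xs ] (f x * p) ≡ ∑ xs f * p
∑-*ʳ xs p f = trans (∑-cong xs (λ x → ℚₚ.*-comm (f x) p)) (trans (∑-*ˡ xs p f) (ℚₚ.*-comm p _))

∑-sub : ∀ (xs : List A) (f g : A → ℚ) → ∑[ x ← xs ] (f x - g x) ≡ ∑ xs f - ∑ xs g
∑-sub []       f g = refl
∑-sub (x ∷ xs) f g = trans (cong ((f x - g x) +_) (∑-sub xs f g))
  (solve 4 (λ a b c d → (a :- b) :+ (c :- d) := (a :+ c) :- (b :+ d)) refl (f x) (g x) (∑ xs f) (∑ xs g))

∑-swap : ∀ (xs : List A) (ys : List B) (f : A → B → ℚ) →
         ∑[ x ← xs ] (∑[ y ← ys ] f x y) ≡ ∑[ y ← ys ] (∑[ x ← xs ] f x y)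
∑-swap []       ys f = sym (∑-zero ys)
∑-swap (x ∷ xs) ys f = trans (cong (∑ ys (f x) +_) (∑-swap xs ys f)) (sym (∑-+ ys (f x) (λ y → ∑[ x′ ← xs ] f x′ y)))

∑-++ : ∀ (xs ys : List A) (f : A → ℚ) → ∑ (xs ++ ys) f ≡ ∑ xs f + ∑ ys f
∑-++ []       ys f = sym (ℚₚ.+-identityˡ _)
∑-++ (x ∷ xs) ys f = trans (cong (f x +_) (∑-++ xs ys f)) (sym (ℚₚ.+-assoc (f x) _ _))

∑-map : ∀ (xs : List A) (h : A → B) (f : B → ℚ) → ∑ (map h xs) f ≡ ∑[ x ← xs ] f (h x)
∑-map []       h f = refl
∑-map (x ∷ xs) h f = cong (f (h x) +_) (∑-map xs h f)

∑-concatMap : ∀ (xs : List A) (h : A → List B) (f : B → ℚ) →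
              ∑ (concatMap h xs) f ≡ ∑[ x ← xs ] ∑ (h x) f
∑-concatMap []       h f = refl
∑-concatMap (x ∷ xs) h f = trans (∑-++ (h x) (concatMap h xs) f) (cong (∑ (h x) f +_) (∑-concatMap xs h f))

∑-mono : ∀ (xs : List A) {f g : A → ℚ} → (∀ x → f x ℚ.≤ g x) → ∑ xs f ℚ.≤ ∑ xs g
∑-mono []       h = ℚₚ.≤-refl
∑-mono (x ∷ xs) h = ℚₚ.+-mono-≤ (h x) (∑-mono xs h)

∑-1 : ∀ (xs : List A) → ∑[ x ← xs ] 1ℚ ≡ ι (length xs)
∑-1 []       = refl
∑-1 (x ∷ xs) = cong (1ℚ +_) (∑-1 xs)

-- Sums over a finite ring

true≢false : true ≢ false
true≢false ()

module RingSums (R : FiniteCommRing) where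
  open FiniteCommRing R
    renaming (_+_ to _⊕_; _*_ to _⊗_; _-_ to _⊖_; -_ to ∼_; refl to ≈-refl; sym to ≈-sym; trans to ≈-trans)
    hiding (zero)
  open import Algebra.Properties.Ring ring

  Resp : (Carrier → ℚ) → Set
  Resp f = ∀ {x y} → x ≈ y → f x ≡ f y

  does-true : ∀ {x y} → x ≈ y → does (x ≟ y) ≡ true
  does-true {x} {y} = dec-true (x ≟ y)

  does-sound : ∀ {x y} → does (x ≟ y) ≡ true → x ≈ y
  does-sound {x} {y} p with x ≟ y
  ... | yes q = q

  does-cong : ∀ {x y x′ y′} → (x ≈ y → x′ ≈ y′) → (x′ ≈ y′ → x ≈ y) → does (x ≟ y) ≡ does (x′ ≟ y′)
  does-cong f g = ⇔→≡ (mk⇔ (λ p → does-true (f (does-sound p))) (λ p → does-true (g (does-sound p))))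

  private
    kronecker-∉ : ∀ {x} (f : Carrier → ℚ) xs → All (λ y → ¬ x ≈ y) xs →
                  ∑[ y ← xs ] (ind (does (x ≟ y)) * f y) ≡ 0ℚ
    kronecker-∉ f []       [] = refl
    kronecker-∉ {x} f (y ∷ ys) (x≉y ∷ r) rewrite dec-false (x ≟ y) x≉y =
      trans (cong₂ _+_ (ℚₚ.*-zeroˡ (f y)) (kronecker-∉ f ys r)) (ℚₚ.+-identityˡ 0ℚ)

    kronecker-∈ : ∀ {x} (f : Carrier → ℚ) → Resp f → ∀ xs → AllPairs (λ y z → ¬ y ≈ z) xs →
                  Any (x ≈_) xs → ∑[ y ← xs ] (ind (does (x ≟ y)) * f y) ≡ f x
    kronecker-∈ {x} f f-resp (y ∷ ys) (r ∷ _) (here x≈y) rewrite dec-true (x ≟ y) x≈y =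
      trans (cong₂ _+_ (ℚₚ.*-identityˡ (f y)) (kronecker-∉ f ys (All.map (λ y≉z x≈z → y≉z (≈-trans (≈-sym x≈y) x≈z)) r)))
        (trans (ℚₚ.+-identityʳ (f y)) (sym (f-resp x≈y)))
    kronecker-∈ {x} f f-resp (y ∷ ys) (r ∷ u) (there p) with x ≟ y
    ... | yes x≈y = let y≉z , x≈z = All.lookupAny r p in contradiction (≈-trans (≈-sym x≈y) x≈z) y≉z
    ... | no _    = trans (cong₂ _+_ (ℚₚ.*-zeroˡ (f y)) (kronecker-∈ f f-resp ys u p)) (ℚₚ.+-identityˡ (f x))

  -- `complete` and `unique` make exactly one entry of `elems` equivalent to x; `Resp f` moves the
  -- value from that entry back to x.
  kronecker : ∀ x (f : Carrier → ℚ) → Resp f → ∑[ y ← elems ] (ind (does (x ≟ y)) * f y) ≡ f x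
  kronecker x f f-resp = kronecker-∈ f f-resp elems unique (complete x)

  -- σ need not permute the list `elems` itself, only its classes. Inserting a Kronecker sum and
  -- exchanging the order of summation avoids any rearrangement of lists.
  ∑-bijection : ∀ (σ σ⁻¹ : Carrier → Carrier) → (∀ {w z} → σ w ≈ z → σ⁻¹ z ≈ w) → (∀ {w z} → σ⁻¹ z ≈ w → σ w ≈ z) →
                ∀ f → Resp f → ∑[ w ← elems ] f (σ w) ≡ ∑ elems f
  ∑-bijection σ σ⁻¹ to from f f-resp = begin
    ∑[ w ← elems ] f (σ w)
      ≡⟨ ∑-cong elems (λ w → sym (kronecker (σ w) f f-resp)) ⟩
    ∑[ w ← elems ] (∑[ z ← elems ] (ind (does (σ w ≟ z)) * f z))
      ≡⟨ ∑-swap elems elems _ ⟩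
    ∑[ z ← elems ] (∑[ w ← elems ] (ind (does (σ w ≟ z)) * f z))
      ≡⟨ ∑-cong elems (λ z → trans (∑-cong elems (λ w → cong (λ b → ind b * f z) (does-cong to from)))
                                   (kronecker (σ⁻¹ z) (λ _ → f z) (λ _ → refl))) ⟩
    ∑ elems f ∎
    where open ≡-Reasoning

  x⊖y⊕y≈x : ∀ x y → (x ⊖ y) ⊕ y ≈ x
  x⊖y⊕y≈x x y = ≈-trans (+-assoc x (∼ y) y) (≈-trans (+-cong ≈-refl (-‿inverseˡ y)) (+-identityʳ x))

  x⊕y⊖y≈x : ∀ x y → (x ⊕ y) ⊖ y ≈ x
  x⊕y⊖y≈x x y = ≈-trans (+-assoc x y (∼ y)) (≈-trans (+-cong ≈-refl (-‿inverseʳ y)) (+-identityʳ x))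

  ⊖-cong : ∀ {x x′ y y′} → x ≈ x′ → y ≈ y′ → x ⊖ y ≈ x′ ⊖ y′
  ⊖-cong p q = +-cong p (-‿cong q)

  x⊖0≈x : ∀ x → x ⊖ 0# ≈ x
  x⊖0≈x x = ≈-trans (+-cong ≈-refl -0#≈0#) (+-identityʳ x)

  x⊖[x⊖y]≈y : ∀ x y → x ⊖ (x ⊖ y) ≈ y
  x⊖[x⊖y]≈y x y = ≈-trans (+-cong ≈-refl (⁻¹-anti-homo‿- x y)) (≈-trans (+-comm x (y ⊖ x)) (x⊖y⊕y≈x y x))

  ∑-shift : ∀ z f → Resp f → ∑[ w ← elems ] f (w ⊖ z) ≡ ∑ elems f
  ∑-shift z = ∑-bijection (_⊖ z) (_⊕ z)
    (λ {w} p → ≈-trans (+-cong (≈-sym p) ≈-refl) (x⊖y⊕y≈x w z))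
    (λ {w} {y} p → ≈-trans (+-cong (≈-sym p) ≈-refl) (x⊕y⊖y≈x y z))

  ∑-reflect : ∀ z f → Resp f → ∑[ w ← elems ] f (z ⊖ w) ≡ ∑ elems f
  ∑-reflect z = ∑-bijection (z ⊖_) (z ⊖_)
    (λ {w} p → ≈-trans (⊖-cong ≈-refl (≈-sym p)) (x⊖[x⊖y]≈y z w))
    (λ {w} {y} p → ≈-trans (⊖-cong ≈-refl (≈-sym p)) (x⊖[x⊖y]≈y z y))

  -- The local functions of Defs cannot be named, so they are recovered by unification once
  -- the list they recurse on has been made a variable.

  count-unique : (P : Carrier → Bool) (G : List Carrier → ℕ) → G [] ≡ 0 →
                 (∀ x xs → G (x ∷ xs) ≡ (if P x then suc (G xs) else G xs)) →
                 ∀ xs → G xs ≡ length (filterB P xs)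
  count-unique P G e₀ e₁ [] = e₀
  count-unique P G e₀ e₁ (x ∷ xs) with P x | e₁ x xs
  ... | true  | e = trans e (cong suc (count-unique P G e₀ e₁ xs))
  ... | false | e = trans e (count-unique P G e₀ e₁ xs)

  mutual
    counted : (Carrier → Bool) → List Carrier → ℕ
    counted P xs = _

    countIn≡length : ∀ P → countIn P ≡ length (filterB P elems)
    countIn≡length P with elems
    ... | xs = count-unique P (counted P) refl (λ _ _ → refl) xs

  ∑-filterB : ∀ P xs (f : Carrier → ℚ) → ∑ (filterB P xs) f ≡ ∑[ x ← xs ] (ind (P x) * f x)
  ∑-filterB P []       f = refl
  ∑-filterB P (x ∷ xs) f with P x
  ... | true  = cong₂ _+_ (sym (ℚₚ.*-identityˡ (f x))) (∑-filterB P xs f)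
  ... | false = trans (∑-filterB P xs f) (trans (sym (ℚₚ.+-identityˡ _)) (cong (_+ _) (sym (ℚₚ.*-zeroˡ (f x)))))

  ι-length-filterB : ∀ P → ι (length (filterB P elems)) ≡ ∑[ x ← elems ] ind (P x)
  ι-length-filterB P = trans (sym (∑-1 (filterB P elems)))
    (trans (∑-filterB P elems (λ _ → 1ℚ)) (∑-cong elems (λ x → ℚₚ.*-identityʳ _)))

  ι-countIn : ∀ P → ι (countIn P) ≡ ∑[ x ← elems ] ind (P x)
  ι-countIn P = trans (cong ι (countIn≡length P)) (ι-length-filterB P)

  ι-card : ι card ≡ ∑[ x ← elems ] 1ℚ
  ι-card = sym (∑-1 elems)

  -- Units, adjacency and arcs

  private
    any-spec : (P : Carrier → Bool) (G : List Carrier → Bool) → G [] ≡ false →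
               (∀ x xs → G (x ∷ xs) ≡ (if P x then true else G xs)) →
               ∀ xs → (G xs ≡ true) ⇔ Any (λ x → P x ≡ true) xs
    any-spec P G e₀ e₁ [] = mk⇔ (λ p → contradiction (trans (sym p) e₀) true≢false) (λ ())
    any-spec P G e₀ e₁ (x ∷ xs) with P x in eq | e₁ x xs
    ... | true  | e = mk⇔ (λ _ → here eq) (λ _ → e)
    ... | false | e = mk⇔ (λ p → there (Equivalence.to (any-spec P G e₀ e₁ xs) (trans (sym e) p)))
                          (λ { (here p) → contradiction (trans (sym p) eq) true≢false
                             ; (there p) → trans e (Equivalence.from (any-spec P G e₀ e₁ xs) p) })

    mutual
      searched : Carrier → List Carrier → Bool
      searched x xs = _

      isUnit-any : ∀ x → (isUnit x ≡ true) ⇔ Any (λ w → does ((x ⊗ w) ≟ 1#) ≡ true) elems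
      isUnit-any x with elems
      ... | xs = any-spec (λ w → does ((x ⊗ w) ≟ 1#)) (searched x) refl (λ _ _ → refl) xs

  isUnit-sound : ∀ x → isUnit x ≡ true → ∃ λ w → x ⊗ w ≈ 1#
  isUnit-sound x p = let w , q = Any.satisfied (Equivalence.to (isUnit-any x) p) in w , does-sound q

  isUnit-complete : ∀ x w → x ⊗ w ≈ 1# → isUnit x ≡ true
  isUnit-complete x w p = Equivalence.from (isUnit-any x)
    (Any.map (λ w≈v → does-true (≈-trans (*-cong ≈-refl (≈-sym w≈v)) p)) (complete w))

  isUnit-transfer : ∀ {x y} → (∀ w → x ⊗ w ≈ 1# → ∃ λ v → y ⊗ v ≈ 1#) → isUnit x ≡ true → isUnit y ≡ true
  isUnit-transfer {x} {y} f p = let w , q = isUnit-sound x p ; v , e = f w q in isUnit-complete y v e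

  isUnit-resp : ∀ {x y} → x ≈ y → isUnit x ≡ isUnit y
  isUnit-resp x≈y = ⇔→≡ (mk⇔
    (isUnit-transfer λ w e → w , ≈-trans (*-cong (≈-sym x≈y) ≈-refl) e)
    (isUnit-transfer λ w e → w , ≈-trans (*-cong x≈y ≈-refl) e))

  isUnit-0 : isUnit 0# ≡ false
  isUnit-0 = ¬-not λ p → let w , e = isUnit-sound 0# p in nontrivial (≈-trans (≈-sym e) (zeroˡ w))

  isUnit-neg : ∀ x y → isUnit (x ⊖ y) ≡ true → isUnit (y ⊖ x) ≡ true
  isUnit-neg x y = isUnit-transfer λ w e → ∼ w ,
    ≈-trans (*-cong (≈-sym (⁻¹-anti-homo‿- x y)) ≈-refl)
      (≈-trans (≈-trans (≈-sym (-‿distribˡ-* (x ⊖ y) (∼ w))) (-‿cong (≈-sym (-‿distribʳ-* (x ⊖ y) w))))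
        (≈-trans (-‿involutive _) e))

  adj≡isUnit : ∀ u v → adj u v ≡ isUnit (u ⊖ v)
  adj≡isUnit u v with u ≟ v
  ... | no _  = refl
  ... | yes p = sym (trans (isUnit-resp (≈-trans (⊖-cong p ≈-refl) (-‿inverseʳ v))) isUnit-0)

  adj-resp : ∀ {u u′ v v′} → u ≈ u′ → v ≈ v′ → adj u v ≡ adj u′ v′
  adj-resp {u} {u′} {v} {v′} p q =
    trans (adj≡isUnit u v) (trans (isUnit-resp (⊖-cong p q)) (sym (adj≡isUnit u′ v′)))

  adj-sym : ∀ u v → adj u v ≡ adj v u
  adj-sym u v = trans (adj≡isUnit u v) (trans (⇔→≡ (mk⇔ (isUnit-neg u v) (isUnit-neg v u))) (sym (adj≡isUnit v u)))

  ∈-filterB⁻ : ∀ P xs {x} → x ∈ filterB P xs → x ∈ xs × P x ≡ true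
  ∈-filterB⁻ P (y ∷ ys) x∈ with P y in eq
  ∈-filterB⁻ P (y ∷ ys) (here refl) | true = here refl , eq
  ∈-filterB⁻ P (y ∷ ys) (there x∈)  | true = let a , b = ∈-filterB⁻ P ys x∈ in there a , b
  ∈-filterB⁻ P (y ∷ ys) x∈ | false = let a , b = ∈-filterB⁻ P ys x∈ in there a , b

  ∈-filterB⁺ : ∀ P xs {x} → x ∈ xs → P x ≡ true → x ∈ filterB P xs
  ∈-filterB⁺ P (y ∷ ys) (here refl) p rewrite p = here refl
  ∈-filterB⁺ P (y ∷ ys) (there x∈) p with P y
  ... | true  = there (∈-filterB⁺ P ys x∈ p)
  ... | false = ∈-filterB⁺ P ys x∈ p

  ι-deg : ∀ u → ι (deg u) ≡ ∑[ v ← elems ] ind (adj u v)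
  ι-deg u = ι-length-filterB (adj u)

  -- The reflection v ↦ u ⊖ v carries the neighbours of u to the units, so every degree is the
  -- number of units.
  deg-regular : ∀ u → deg u ≡ deg 0#
  deg-regular u = ι-injective _ _ (trans (degree u) (sym (degree 0#)))
    where
    degree : ∀ u → ι (deg u) ≡ ∑[ z ← elems ] ind (isUnit z)
    degree u = trans (ι-deg u) (trans (∑-cong elems (λ v → cong ind (adj≡isUnit u v)))
      (∑-reflect u (λ z → ind (isUnit z)) (λ p → cong ind (isUnit-resp p))))

  ∑-arcs : ∀ (f : Arc → ℚ) → ∑ arcs f ≡ ∑[ x ← elems ] (∑[ y ← elems ] (ind (adj x y) * f (x , y)))
  ∑-arcs f = trans (∑-concatMap elems _ f) (∑-cong elems λ x →
    trans (∑-map (filterB (adj x) elems) (x ,_) f) (∑-filterB (adj x) elems (λ y → f (x , y))))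

  ∈-arcs⁻ : ∀ {a} → a ∈ arcs → adj (proj₁ a) (proj₂ a) ≡ true
  ∈-arcs⁻ a∈ with find (∈-concatMap⁻ _ {xs = elems} a∈)
  ... | x , x∈ , a∈′ with ∈-map⁻ (x ,_) a∈′
  ... | y , y∈ , refl = proj₂ (∈-filterB⁻ (adj x) elems y∈)

  -- `Periodic` speaks only of pairs listed in `arcs`; this carries its equation over to arbitrary
  -- adjacent pairs.
  arc-representative : ∀ x y → adj x y ≡ true → ∃ λ x′ → ∃ λ y′ → x ≈ x′ × y ≈ y′ × (x′ , y′) ∈ arcs
  arc-representative x y p with find (complete x) | find (complete y)
  ... | x′ , x′∈ , x≈x′ | y′ , y′∈ , y≈y′ = x′ , y′ , x≈x′ , y≈y′ ,
    ∈-concatMap⁺ _ (lose x′∈ (∈-map⁺ (x′ ,_) (∈-filterB⁺ (adj x′) elems y′∈ (trans (adj-resp (≈-sym x≈x′) (≈-sym y≈y′)) p))))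

-- The Grover walk as an operator on arc functions

module Walk (R : FiniteCommRing) where
  open FiniteCommRing R
    renaming (_+_ to _⊕_; _*_ to _⊗_; _-_ to _⊖_; -_ to ∼_; refl to ≈-refl; sym to ≈-sym; trans to ≈-trans)
    hiding (zero)
  open RingSums R

  ArcFunction : Set
  ArcFunction = Arc → ℚ

  Resp₂ : ArcFunction → Set
  Resp₂ g = ∀ {x x′ y y′} → x ≈ x′ → y ≈ y′ → g (x , y) ≡ g (x′ , y′)

  infix 4 _≗ᵃ_
  -- Restricted to adjacent pairs because a sum over `arcs` never sees the other values of an arc
  -- function.
  _≗ᵃ_ : ArcFunction → ArcFunction → Set
  g ≗ᵃ h = ∀ x y → adj x y ≡ true → g (x , y) ≡ h (x , y)

  infixr 7 _▷_
  _▷_ : Mat → ArcFunction → ArcFunction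
  (A ▷ g) a = ∑[ c ← arcs ] (A a c * g c)

  sumℚ-map : ∀ {A : Set} (f : A → ℚ) xs → sumℚ (map f xs) ≡ ∑ xs f
  sumℚ-map f []       = refl
  sumℚ-map f (x ∷ xs) = cong (f x +_) (sumℚ-map f xs)

  δ≡ind : ∀ b → δ b ≡ ind b
  δ≡ind true  = refl
  δ≡ind false = refl

  ·-▷ : ∀ A B g a → ((A · B) ▷ g) a ≡ (A ▷ B ▷ g) a
  ·-▷ A B g a = begin
    ∑[ c ← arcs ] ((A · B) a c * g c)
      ≡⟨ ∑-cong arcs (λ c → cong (_* g c) (sumℚ-map (λ b → A a b * B b c) arcs)) ⟩
    ∑[ c ← arcs ] (∑ arcs (λ b → A a b * B b c) * g c)
      ≡⟨ ∑-cong arcs (λ c → sym (∑-*ʳ arcs (g c) _)) ⟩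
    ∑[ c ← arcs ] (∑[ b ← arcs ] (A a b * B b c * g c))
      ≡⟨ ∑-swap arcs arcs _ ⟩
    ∑[ b ← arcs ] (∑[ c ← arcs ] (A a b * B b c * g c))
      ≡⟨ ∑-cong arcs (λ b → trans (∑-cong arcs (λ c → ℚₚ.*-assoc (A a b) (B b c) (g c))) (∑-*ˡ arcs (A a b) _)) ⟩
    (A ▷ B ▷ g) a ∎
    where open ≡-Reasoning

  ▷-congʳ : ∀ A {g h} → g ≗ᵃ h → ∀ a → (A ▷ g) a ≡ (A ▷ h) a
  ▷-congʳ A eq a = ∑-cong-∈ arcs λ { (x , y) c∈ → cong (A a (x , y) *_) (eq x y (∈-arcs⁻ c∈)) }

  eqB-resp : ∀ {x x′ y y′} → x ≈ x′ → y ≈ y′ → eqB x y ≡ eqB x′ y′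
  eqB-resp p q = does-cong (λ e → ≈-trans (≈-sym p) (≈-trans e q)) (λ e → ≈-trans p (≈-trans e (≈-sym q)))

  kronecker₂ : ∀ x y (F : ArcFunction) → Resp₂ F →
               ∑[ u ← elems ] (∑[ v ← elems ] (ind (eqB x u) * ind (eqB y v) * F (u , v))) ≡ F (x , y)
  kronecker₂ x y F F-resp = begin
    ∑[ u ← elems ] (∑[ v ← elems ] (ind (eqB x u) * ind (eqB y v) * F (u , v)))
      ≡⟨ ∑-cong elems (λ u → trans (∑-cong elems (λ v → ℚₚ.*-assoc (ind (eqB x u)) (ind (eqB y v)) (F (u , v)))) (∑-*ˡ elems (ind (eqB x u)) (λ v → ind (eqB y v) * F (u , v)))) ⟩
    ∑[ u ← elems ] (ind (eqB x u) * (∑[ v ← elems ] (ind (eqB y v) * F (u , v))))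
      ≡⟨ ∑-cong elems (λ u → cong (ind (eqB x u) *_) (kronecker y (λ v → F (u , v)) (F-resp ≈-refl))) ⟩
    ∑[ u ← elems ] (ind (eqB x u) * F (u , y))
      ≡⟨ kronecker x (λ u → F (u , y)) (λ p → F-resp p ≈-refl) ⟩
    F (x , y) ∎
    where open ≡-Reasoning

  -- The adjacency weight that `∑-arcs` produces is absorbed into the function, which leaves a sum
  -- over all pairs of elements for `kronecker₂`.
  masked : ArcFunction → ArcFunction
  masked g (x , y) = ind (adj x y) * g (x , y)

  masked-resp : ∀ {g} → Resp₂ g → Resp₂ (masked g)
  masked-resp g-resp p q = cong₂ _*_ (cong ind (adj-resp p q)) (g-resp p q)

  masked-adj : ∀ g x y → adj x y ≡ true → masked g (x , y) ≡ g (x , y)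
  masked-adj g x y p rewrite p = ℚₚ.*-identityˡ _

  δ-∧ : ∀ a b → δ (a ∧ b) ≡ ind a * ind b
  δ-∧ a b = trans (δ≡ind (a ∧ b)) (ind-∧ a b)

  I▷ : ∀ g → Resp₂ g → (I ▷ g) ≗ᵃ g
  I▷ g g-resp x y p = begin
    (I ▷ g) (x , y)
      ≡⟨ ∑-arcs _ ⟩
    ∑[ u ← elems ] (∑[ v ← elems ] (ind (adj u v) * (δ (eqB x u ∧ eqB y v) * g (u , v))))
      ≡⟨ ∑-cong elems (λ u → ∑-cong elems (λ v → trans (cong (λ d → ind (adj u v) * (d * g (u , v))) (δ-∧ (eqB x u) (eqB y v)))
           (solve 4 (λ a b c d → a :* (b :* c :* d) := b :* c :* (a :* d)) refl (ind (adj u v)) (ind (eqB x u)) (ind (eqB y v)) (g (u , v))))) ⟩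
    ∑[ u ← elems ] (∑[ v ← elems ] (ind (eqB x u) * ind (eqB y v) * masked g (u , v)))
      ≡⟨ kronecker₂ x y (masked g) (masked-resp g-resp) ⟩
    masked g (x , y)
      ≡⟨ masked-adj g x y p ⟩
    g (x , y) ∎
    where open ≡-Reasoning

  S▷ : ∀ g → Resp₂ g → (S ▷ g) ≗ᵃ (λ { (x , y) → g (y , x) })
  S▷ g g-resp x y p = begin
    (S ▷ g) (x , y)
      ≡⟨ ∑-arcs _ ⟩
    ∑[ u ← elems ] (∑[ v ← elems ] (ind (adj u v) * (δ (eqB x v ∧ eqB y u) * g (u , v))))
      ≡⟨ ∑-cong elems (λ u → ∑-cong elems (λ v → trans (cong (λ d → ind (adj u v) * (d * g (u , v))) (δ-∧ (eqB x v) (eqB y u)))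
           (solve 4 (λ a b c d → a :* (b :* c :* d) := c :* b :* (a :* d)) refl (ind (adj u v)) (ind (eqB x v)) (ind (eqB y u)) (g (u , v))))) ⟩
    ∑[ u ← elems ] (∑[ v ← elems ] (ind (eqB y u) * ind (eqB x v) * masked g (u , v)))
      ≡⟨ kronecker₂ y x (masked g) (masked-resp g-resp) ⟩
    masked g (y , x)
      ≡⟨ masked-adj g y x (trans (adj-sym y x) p) ⟩
    g (y , x) ∎
    where open ≡-Reasoning

  r : ℚ
  r = fracℚ 1 (deg 0#)

  -- Twice the mean of g over the arcs with head x, that is, the effect of 2N*N. The degree is read
  -- off at `0#` by regularity.
  inflow : ArcFunction → Carrier → ℚ
  inflow g x = 2ℚ * r * (∑[ w ← elems ] (ind (adj w x) * g (w , x)))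

  reflect : ArcFunction → ArcFunction
  reflect g (x , y) = inflow g y - g (x , y)

  step : ArcFunction → ArcFunction
  step g (x , y) = inflow g x - g (y , x)

  inflow-resp : ∀ {g} → Resp₂ g → Resp (inflow g)
  inflow-resp g-resp p = cong (2ℚ * r *_) (∑-cong elems (λ w → cong₂ _*_ (cong ind (adj-resp ≈-refl p)) (g-resp ≈-refl p)))

  inflow-cong : ∀ {g h} → g ≗ᵃ h → ∀ x → inflow g x ≡ inflow h x
  inflow-cong eq x = cong (2ℚ * r *_) (∑-cong elems (λ w → ind-*-cong (adj w x) (eq w x)))

  step-resp : ∀ {g} → Resp₂ g → Resp₂ (step g)
  step-resp g-resp p q = cong₂ _-_ (inflow-resp g-resp p) (g-resp q p)

  reflect-resp : ∀ {g} → Resp₂ g → Resp₂ (reflect g)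
  reflect-resp g-resp p q = cong₂ _-_ (inflow-resp g-resp q) (g-resp p q)

  C▷ : ∀ g → Resp₂ g → (C ▷ g) ≗ᵃ reflect g
  C▷ g g-resp x y p = begin
    (C ▷ g) (x , y)
      ≡⟨ ∑-cong arcs (λ { c@(u , v) → trans (cong (λ d → (2ℚ * (d * s) - I (x , y) c) * g c) (δ≡ind (eqB y v)))
           (solve 5 (λ t d s i z → (t :* (d :* s) :- i) :* z := t :* s :* (d :* z) :- i :* z) refl
             2ℚ (ind (eqB y v)) s (I (x , y) c) (g c)) }) ⟩
    ∑[ c ← arcs ] (2ℚ * s * (ind (eqB y (t c)) * g c) - I (x , y) c * g c)
      ≡⟨ ∑-sub arcs _ _ ⟩
    (∑[ c ← arcs ] (2ℚ * s * (ind (eqB y (t c)) * g c))) - (I ▷ g) (x , y)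
      ≡⟨ cong₂ _-_ (trans (∑-*ˡ arcs (2ℚ * s) _) (cong₂ (λ n q → 2ℚ * fracℚ 1 n * q) (deg-regular y) heads))
                   (I▷ g g-resp x y p) ⟩
    reflect g (x , y) ∎
    where
    open ≡-Reasoning
    s = fracℚ 1 (deg y)
    heads : ∑[ c ← arcs ] (ind (eqB y (t c)) * g c) ≡ ∑[ w ← elems ] (ind (adj w y) * g (w , y))
    heads = trans (∑-arcs _) (∑-cong elems λ u →
      trans (∑-cong elems λ v → solve 3 (λ a b c → a :* (b :* c) := b :* (a :* c)) refl (ind (adj u v)) (ind (eqB y v)) (g (u , v)))
            (kronecker y (λ v → masked g (u , v)) (masked-resp g-resp ≈-refl)))

  -- The coin subtracts g from the inflow at the head, and the shift exchanges tail and head.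
  -- Passing from g to h allows g to be a column of a matrix power, for which compatibility with ≈
  -- has not been established, while h is a walk that has it.
  U▷ : ∀ {g h} → g ≗ᵃ h → Resp₂ h → (U ▷ g) ≗ᵃ step h
  U▷ {g} {h} eq h-resp x y p = begin
    (U ▷ g) (x , y)              ≡⟨ ▷-congʳ U eq (x , y) ⟩
    (U ▷ h) (x , y)              ≡⟨ ·-▷ S C h (x , y) ⟩
    (S ▷ C ▷ h) (x , y)          ≡⟨ ▷-congʳ S (C▷ h h-resp) (x , y) ⟩
    (S ▷ reflect h) (x , y)      ≡⟨ S▷ (reflect h) (reflect-resp h-resp) x y p ⟩
    step h (x , y)               ∎
    where open ≡-Reasoning

  walk : ℕ → ArcFunction → ArcFunction
  walk zero    g = g
  walk (suc n) g = step (walk n g)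

  walk-resp : ∀ n {g} → Resp₂ g → Resp₂ (walk n g)
  walk-resp zero    g-resp = g-resp
  walk-resp (suc n) g-resp = step-resp (walk-resp n g-resp)

  U^▷ : ∀ n g → Resp₂ g → (U ^ n ▷ g) ≗ᵃ walk n g
  U^▷ zero    g g-resp         = I▷ g g-resp
  U^▷ (suc n) g g-resp x y p = trans (·-▷ U (U ^ n) g (x , y)) (U▷ (U^▷ n g g-resp) (walk-resp n g-resp) x y p)

  I-resp : ∀ b → Resp₂ (λ a → I a b)
  I-resp b p q = cong₂ (λ c d → δ (c ∧ d)) (eqB-resp p ≈-refl) (eqB-resp q ≈-refl)

  -- Powers multiply on the left, so each column evolves independently: column b is the walk started
  -- from the point mass at b. This turns a statement about arc functions into one about matrix
  -- entries.
  U^-column : ∀ n b → (λ a → (U ^ n) a b) ≗ᵃ walk n (λ a → I a b)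
  U^-column zero    b x y p = refl
  U^-column (suc n) b x y p = trans (sumℚ-map (λ c → U (x , y) c * (U ^ n) c b) arcs)
    (U▷ (U^-column n b) (walk-resp n (I-resp b)) x y p)

  periodic⇒ : ((τ , _) : Periodic) → ∀ g → Resp₂ g → walk τ g ≗ᵃ g
  periodic⇒ (τ , _ , U^τ≡I) g g-resp x y p = let x′ , y′ , x≈x′ , y≈y′ , a∈ = arc-representative x y p in begin
    walk τ g (x , y)        ≡⟨ walk-resp τ g-resp x≈x′ y≈y′ ⟩
    walk τ g (x′ , y′)      ≡⟨ U^▷ τ g g-resp x′ y′ (∈-arcs⁻ a∈) ⟨
    (U ^ τ ▷ g) (x′ , y′)   ≡⟨ ∑-cong-∈ arcs (λ c c∈ → cong (_* g c) (U^τ≡I (x′ , y′) c a∈ c∈)) ⟩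
    (I ▷ g) (x′ , y′)       ≡⟨ I▷ g g-resp x′ y′ (∈-arcs⁻ a∈) ⟩
    g (x′ , y′)             ≡⟨ g-resp x≈x′ y≈y′ ⟨
    g (x , y)               ∎
    where open ≡-Reasoning

  ⇒periodic : ∀ τ → 1 ℕ.≤ τ → (∀ g → Resp₂ g → walk τ g ≗ᵃ g) → Periodic
  ⇒periodic τ 1≤τ h = τ , 1≤τ , λ { (x , y) b a∈ _ →
    trans (U^-column τ b x y (∈-arcs⁻ a∈)) (h (λ a → I a b) (I-resp b) x y (∈-arcs⁻ a∈)) }

-- Blow-ups of short cycles are periodic

module Cosets (R : FiniteCommRing) (J : FiniteCommRing.Carrier R → Bool) (J-ideal : FiniteCommRing.IsIdeal R J) where
  open FiniteCommRing R
    renaming (_+_ to _⊕_; _*_ to _⊗_; _-_ to _⊖_; -_ to ∼_; refl to ≈-refl; sym to ≈-sym; trans to ≈-trans)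
    hiding (zero)
  open IsIdeal J-ideal
  open RingSums R
  open import Algebra.Properties.Ring ring
  open import Algebra.Properties.CommutativeSemigroup +-commutativeSemigroup using (interchange)

  infix 4 _≋_
  _≋_ : Carrier → Carrier → Set
  x ≋ y = J (x ⊖ y) ≡ true

  neg∈ : ∀ x → J x ≡ true → J (∼ x) ≡ true
  neg∈ x x∈ = trans (resp (≈-sym (-1*x≈-x x))) (*-cl (∼ 1#) x x∈)

  ≈⇒≋ : ∀ {x y} → x ≈ y → x ≋ y
  ≈⇒≋ {x} {y} x≈y = trans (resp (≈-trans (⊖-cong x≈y ≈-refl) (-‿inverseʳ y))) zero∈

  ≋-refl : ∀ {x} → x ≋ x
  ≋-refl = ≈⇒≋ ≈-refl

  ≋-sym : ∀ {x y} → x ≋ y → y ≋ x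
  ≋-sym {x} {y} p = trans (resp (≈-sym (⁻¹-anti-homo‿- x y))) (neg∈ (x ⊖ y) p)

  ≋-trans : ∀ {x y z} → x ≋ y → y ≋ z → x ≋ z
  ≋-trans {x} {y} {z} p q = trans (resp (≈-sym eq)) (+-cl (x ⊖ y) (y ⊖ z) p q)
    where
    eq : (x ⊖ y) ⊕ (y ⊖ z) ≈ x ⊖ z
    eq = ≈-trans (≈-sym (+-assoc (x ⊖ y) y (∼ z))) (+-cong (x⊖y⊕y≈x x y) ≈-refl)

  ≋-+ : ∀ {x x′ y y′} → x ≋ x′ → y ≋ y′ → x ⊕ y ≋ x′ ⊕ y′
  ≋-+ {x} {x′} {y} {y′} p q = trans (resp (≈-sym eq)) (+-cl (x ⊖ x′) (y ⊖ y′) p q)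
    where
    eq : (x ⊖ x′) ⊕ (y ⊖ y′) ≈ (x ⊕ y) ⊖ (x′ ⊕ y′)
    eq = ≈-trans (interchange x (∼ x′) y (∼ y′)) (+-cong ≈-refl (-‿+-comm x′ y′))

  ≋-neg : ∀ {x y} → x ≋ y → ∼ x ≋ ∼ y
  ≋-neg {x} {y} p = trans (resp (-‿+-comm x (∼ y))) (neg∈ (x ⊖ y) p)

  ≋-⊖ : ∀ {x x′ y y′} → x ≋ x′ → y ≋ y′ → x ⊖ y ≋ x′ ⊖ y′
  ≋-⊖ p q = ≋-+ p (≋-neg q)

  ≋-*ˡ : ∀ z {x y} → x ≋ y → z ⊗ x ≋ z ⊗ y
  ≋-*ˡ z {x} {y} p = trans (resp (≈-sym (x[y-z]≈xy-xz z x y))) (*-cl z (x ⊖ y) p)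

  ≋-* : ∀ {x x′ y y′} → x ≋ x′ → y ≋ y′ → x ⊗ y ≋ x′ ⊗ y′
  ≋-* {x} {x′} {y} {y′} p q =
    ≋-trans (≋-*ˡ x q) (≋-trans (≈⇒≋ (*-comm x y′)) (≋-trans (≋-*ˡ y′ p) (≈⇒≋ (*-comm y′ x′))))

  ∈⇒≋0 : ∀ {x} → J x ≡ true → x ≋ 0#
  ∈⇒≋0 {x} p = trans (resp (x⊖0≈x x)) p

  ≋0⇒∈ : ∀ {x} → x ≋ 0# → J x ≡ true
  ≋0⇒∈ {x} p = trans (resp (≈-sym (x⊖0≈x x))) p

  ∈-≋ : ∀ {x y} → x ≋ y → J x ≡ J y
  ∈-≋ p = ⇔→≡ (mk⇔ (λ q → ≋0⇒∈ (≋-trans (≋-sym p) (∈⇒≋0 q))) (λ q → ≋0⇒∈ (≋-trans p (∈⇒≋0 q))))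

  size : ℕ
  size = countIn J

  size≢0 : size ≢ 0
  size≢0 e with find (complete 0#)
  ... | z , z∈ , 0≈z = nonempty (∈-filterB⁺ J elems z∈ (trans (resp (≈-sym 0≈z)) zero∈)) (trans (sym (countIn≡length J)) e)
    where
    nonempty : ∀ {xs : List Carrier} → z ∈ xs → length xs ≢ 0
    nonempty (here _) ()
    nonempty (there _) ()

  ind-resp : Resp (λ x → ind (J x))
  ind-resp p = cong ind (resp p)

  ∑-coset : ∀ z → ∑[ w ← elems ] ind (J (w ⊖ z)) ≡ ι size
  ∑-coset z = trans (∑-shift z (λ x → ind (J x)) ind-resp) (sym (ι-countIn J))

fracℚ-inverse : ∀ R n → n ≢ 0 → FiniteCommRing.fracℚ R 1 n * ι n ≡ 1ℚ
fracℚ-inverse R zero    n≢0 = contradiction refl n≢0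
fracℚ-inverse R (suc n) _   = 1/suc*ι n

module CycleBlowup
  (R : FiniteCommRing) (J : FiniteCommRing.Carrier R → Bool) (J-ideal : FiniteCommRing.IsIdeal R J) where
  open FiniteCommRing R
    renaming (_+_ to _⊕_; _*_ to _⊗_; _-_ to _⊖_; -_ to ∼_; refl to ≈-refl; sym to ≈-sym; trans to ≈-trans)
    hiding (zero)
  open RingSums R
  open Walk R
  open Cosets R J J-ideal
  open import Algebra.Properties.Ring ring

  μ : ℚ
  μ = fracℚ 1 size

  μ*size : μ * ι size ≡ 1ℚ
  μ*size = fracℚ-inverse R size size≢0

  avg : (Carrier → ℚ) → Carrier → ℚ
  avg f z = μ * (∑[ w ← elems ] (ind (J (w ⊖ z)) * f w))

  avg-cong : ∀ {f f′} z → (∀ w → w ≋ z → f w ≡ f′ w) → avg f z ≡ avg f′ z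
  avg-cong z h = cong (μ *_) (∑-cong elems (λ w → ind-*-cong (J (w ⊖ z)) (h w)))

  avg-resp : ∀ f {z z′} → z ≋ z′ → avg f z ≡ avg f z′
  avg-resp f p = cong (μ *_) (∑-cong elems (λ w → cong (λ b → ind b * f w) (∈-≋ (≋-⊖ ≋-refl p))))

  avg-const : ∀ p z → avg (λ _ → p) z ≡ p
  avg-const p z = begin
    μ * (∑[ w ← elems ] (ind (J (w ⊖ z)) * p))  ≡⟨ cong (μ *_) (trans (∑-*ʳ elems p _) (cong (_* p) (∑-coset z))) ⟩
    μ * (ι size * p)                            ≡⟨ ℚₚ.*-assoc μ (ι size) p ⟨
    μ * ι size * p                              ≡⟨ cong (_* p) μ*size ⟩
    1ℚ * p                                      ≡⟨ ℚₚ.*-identityˡ p ⟩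
    p                                           ∎
    where open ≡-Reasoning

  avg-inv : ∀ {f p} z → (∀ w → w ≋ z → f w ≡ p) → avg f z ≡ p
  avg-inv {p = p} z h = trans (avg-cong z h) (avg-const p z)

  avg-sub : ∀ f g z → avg (λ w → f w - g w) z ≡ avg f z - avg g z
  avg-sub f g z = begin
    μ * (∑[ w ← elems ] (ind (J (w ⊖ z)) * (f w - g w)))
      ≡⟨ cong (μ *_) (trans (∑-cong elems (λ w → solve 3 (λ a b c → a :* (b :- c) := a :* b :- a :* c) refl (ind (J (w ⊖ z))) (f w) (g w)))
                            (∑-sub elems _ _)) ⟩
    μ * (∑ elems (λ w → ind (J (w ⊖ z)) * f w) - ∑ elems (λ w → ind (J (w ⊖ z)) * g w))
      ≡⟨ solve 3 (λ a b c → a :* (b :- c) := a :* b :- a :* c) refl μ (∑ elems (λ w → ind (J (w ⊖ z)) * f w)) (∑ elems (λ w → ind (J (w ⊖ z)) * g w)) ⟩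
    avg f z - avg g z ∎
    where open ≡-Reasoning

  avg-+ : ∀ f g z → avg (λ w → f w + g w) z ≡ avg f z + avg g z
  avg-+ f g z = begin
    avg (λ w → f w + g w) z                ≡⟨ solve 2 (λ a b → a := (a :- b) :+ b) refl (avg (λ w → f w + g w) z) (avg g z) ⟩
    (avg (λ w → f w + g w) z - avg g z) + avg g z   ≡⟨ cong (_+ avg g z) (avg-sub (λ w → f w + g w) g z) ⟨
    avg (λ w → f w + g w - g w) z + avg g z         ≡⟨ cong (_+ avg g z) (avg-cong z (λ w _ → solve 2 (λ a b → a :+ b :- b := a) refl (f w) (g w))) ⟩
    avg f z + avg g z ∎
    where open ≡-Reasoning

  avg-swap : ∀ (F : Carrier → Carrier → ℚ) z z′ →
             avg (λ w → avg (λ v → F w v) z′) z ≡ avg (λ v → avg (λ w → F w v) z) z′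
  avg-swap F z z′ = trans (pull F z z′) (trans (cong (λ s → μ * (μ * s)) inner) (sym (pull (λ v w → F w v) z′ z)))
    where
    pull : ∀ F z z′ → avg (λ w → avg (F w) z′) z ≡
           μ * (μ * (∑[ w ← elems ] (∑[ v ← elems ] (ind (J (w ⊖ z)) * (ind (J (v ⊖ z′)) * F w v)))))
    pull F z z′ = cong (μ *_) (trans
      (∑-cong elems (λ w → trans
        (solve 3 (λ a b c → a :* (b :* c) := b :* (a :* c)) refl (ind (J (w ⊖ z))) μ (∑ elems (λ v → ind (J (v ⊖ z′)) * F w v)))
        (cong (μ *_) (sym (∑-*ˡ elems (ind (J (w ⊖ z))) (λ v → ind (J (v ⊖ z′)) * F w v))))))
      (∑-*ˡ elems μ _))
    inner : ∑[ w ← elems ] (∑[ v ← elems ] (ind (J (w ⊖ z)) * (ind (J (v ⊖ z′)) * F w v))) ≡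
            ∑[ v ← elems ] (∑[ w ← elems ] (ind (J (v ⊖ z′)) * (ind (J (w ⊖ z)) * F w v)))
    inner = trans (∑-swap elems elems _) (∑-cong elems λ v → ∑-cong elems λ w →
      solve 3 (λ a b c → a :* (b :* c) := b :* (a :* c)) refl (ind (J (w ⊖ z))) (ind (J (v ⊖ z′))) (F w v))

  avg₂ : ArcFunction → ArcFunction
  avg₂ g (x , y) = avg (λ w → avg (λ v → g (w , v)) y) x

  Invariant : ArcFunction → Set
  Invariant k = ∀ {x x′ y y′} → x ≋ x′ → y ≋ y′ → k (x , y) ≡ k (x′ , y′)

  avg₂-invariant : ∀ g → Invariant (avg₂ g)
  avg₂-invariant g {x} {x′} p q = trans (avg-resp _ p) (avg-cong x′ (λ w _ → avg-resp _ q))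

  step-+ : ∀ {g h k} → (∀ a → g a ≡ h a + k a) → ∀ a → step g a ≡ step h a + step k a
  step-+ {g} {h} {k} eq (x , y) = begin
    2ℚ * r * (∑[ w ← elems ] (ind (adj w x) * g (w , x))) - g (y , x)
      ≡⟨ cong₂ (λ a b → 2ℚ * r * a - b)
           (trans (∑-cong elems (λ w → trans (cong (ind (adj w x) *_) (eq (w , x))) (ℚₚ.*-distribˡ-+ (ind (adj w x)) (h (w , x)) (k (w , x)))))
                  (∑-+ elems _ _))
           (eq (y , x)) ⟩
    2ℚ * r * (Σh + Σk) - (h (y , x) + k (y , x))
      ≡⟨ solve 5 (λ a b c d e → a :* (b :+ c) :- (d :+ e) := (a :* b :- d) :+ (a :* c :- e)) refl (2ℚ * r) Σh Σk (h (y , x)) (k (y , x)) ⟩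
    step h (x , y) + step k (x , y) ∎
    where
    open ≡-Reasoning
    Σh = ∑[ w ← elems ] (ind (adj w x) * h (w , x))
    Σk = ∑[ w ← elems ] (ind (adj w x) * k (w , x))

  walk-+ : ∀ n {g h k} → (∀ a → g a ≡ h a + k a) → ∀ a → walk n g a ≡ walk n h a + walk n k a
  walk-+ zero    eq = eq
  walk-+ (suc n) eq = step-+ (walk-+ n eq)

  -- The factor c treats both shapes at once. If 1 ≋ -1, the cosets of x + 1 and x - 1 coincide, the
  -- right-hand side of `adj-cosets` counts them twice, and c = 2; if they are disjoint, c = 1. The
  -- cycle lengths 2, 3 and 6 all divide the 6 of `six`.
  module _
    (c : ℚ) (c≢0 : c ≢ 0ℚ)
    (adj-cosets : ∀ w x → c * ind (adj w x) ≡ ind (J (w ⊖ (x ⊕ 1#))) + ind (J (w ⊖ (x ⊖ 1#))))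
    (six : ∀ x → x ⊕ 1# ⊕ 1# ⊕ 1# ⊕ 1# ⊕ 1# ⊕ 1# ≋ x)
    where

    c*deg : c * ι (deg 0#) ≡ 2ℚ * ι size
    c*deg = begin
      c * ι (deg 0#)
        ≡⟨ cong (c *_) (trans (ι-deg 0#) (∑-cong elems (λ v → cong ind (adj-sym 0# v)))) ⟩
      c * (∑[ v ← elems ] ind (adj v 0#))
        ≡⟨ ∑-*ˡ elems c _ ⟨
      ∑[ v ← elems ] (c * ind (adj v 0#))
        ≡⟨ trans (∑-cong elems (λ v → adj-cosets v 0#)) (∑-+ elems _ _) ⟩
      ∑ elems (λ v → ind (J (v ⊖ (0# ⊕ 1#)))) + ∑ elems (λ v → ind (J (v ⊖ (0# ⊖ 1#))))
        ≡⟨ cong₂ _+_ (∑-coset (0# ⊕ 1#)) (∑-coset (0# ⊖ 1#)) ⟩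
      ι size + ι size
        ≡⟨ solve 1 (λ a → a :+ a := (con 1ℚ :+ con 1ℚ) :* a) refl (ι size) ⟩
      2ℚ * ι size ∎
      where open ≡-Reasoning

    deg≢0 : deg 0# ≢ 0
    deg≢0 e = ι≢0 size size≢0 (*-cancelˡ-≡0 2ℚ (λ ()) (trans (sym c*deg) (trans (cong (λ n → c * ι n) e) (ℚₚ.*-zeroʳ c))))

    -- Summing `adj-cosets` over all vertices gives c · deg = 2 |J|. Hence the weight 2/deg of the
    -- walk is c/|J|, and the inflow becomes a sum of two coset means whichever value c has.
    2r≡cμ : 2ℚ * r ≡ μ * c
    2r≡cμ = begin
      2ℚ * r                        ≡⟨ ℚₚ.*-identityˡ _ ⟨
      1ℚ * (2ℚ * r)                 ≡⟨ cong (_* (2ℚ * r)) μ*size ⟨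
      μ * ι size * (2ℚ * r)         ≡⟨ solve 4 (λ a b t d → a :* b :* (t :* d) := a :* ((t :* b) :* d)) refl μ (ι size) 2ℚ r ⟩
      μ * (2ℚ * ι size * r)         ≡⟨ cong (λ s → μ * (s * r)) c*deg ⟨
      μ * (c * ι (deg 0#) * r)      ≡⟨ solve 4 (λ a b d e → a :* (b :* d :* e) := a :* b :* (e :* d)) refl μ c (ι (deg 0#)) r ⟩
      μ * c * (r * ι (deg 0#))      ≡⟨ cong (μ * c *_) (fracℚ-inverse R (deg 0#) deg≢0) ⟩
      μ * c * 1ℚ                    ≡⟨ ℚₚ.*-identityʳ _ ⟩
      μ * c                         ∎
      where open ≡-Reasoning

    inflow≡avg : ∀ g x → inflow g x ≡ avg (λ w → g (w , x)) (x ⊕ 1#) + avg (λ w → g (w , x)) (x ⊖ 1#)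
    inflow≡avg g x = begin
      2ℚ * r * Σg
        ≡⟨ cong (_* Σg) 2r≡cμ ⟩
      μ * c * Σg
        ≡⟨ trans (ℚₚ.*-assoc μ c Σg) (cong (μ *_) (sym (∑-*ˡ elems c _))) ⟩
      μ * (∑[ w ← elems ] (c * (ind (adj w x) * g (w , x))))
        ≡⟨ cong (μ *_) (∑-cong elems (λ w → trans (sym (ℚₚ.*-assoc c (ind (adj w x)) (g (w , x))))
             (trans (cong (_* g (w , x)) (adj-cosets w x)) (ℚₚ.*-distribʳ-+ (g (w , x)) (ind (J (w ⊖ (x ⊕ 1#)))) (ind (J (w ⊖ (x ⊖ 1#)))))))) ⟩
      μ * (∑[ w ← elems ] (ind (J (w ⊖ (x ⊕ 1#))) * g (w , x) + ind (J (w ⊖ (x ⊖ 1#))) * g (w , x)))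
        ≡⟨ trans (cong (μ *_) (∑-+ elems _ _)) (ℚₚ.*-distribˡ-+ μ _ _) ⟩
      avg (λ w → g (w , x)) (x ⊕ 1#) + avg (λ w → g (w , x)) (x ⊖ 1#) ∎
      where
      open ≡-Reasoning
      Σg = ∑[ w ← elems ] (ind (adj w x) * g (w , x))

    inflow-invariant : ∀ {k} → Invariant k → ∀ x → inflow k x ≡ k (x ⊕ 1# , x) + k (x ⊖ 1# , x)
    inflow-invariant {k} k-inv x = trans (inflow≡avg k x)
      (cong₂ _+_ (avg-inv (x ⊕ 1#) (λ w p → k-inv p ≋-refl)) (avg-inv (x ⊖ 1#) (λ w p → k-inv p ≋-refl)))

    step-invariant : ∀ {k} → Invariant k → Invariant (step k)
    step-invariant {k} k-inv {x} {x′} p q = cong₂ _-_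
      (trans (inflow-invariant k-inv x)
        (trans (cong₂ _+_ (k-inv (≋-+ p ≋-refl) p) (k-inv (≋-⊖ p ≋-refl) p)) (sym (inflow-invariant k-inv x′))))
      (k-inv q p)

    walk-invariant : ∀ n {k} → Invariant k → Invariant (walk n k)
    walk-invariant zero    k-inv = k-inv
    walk-invariant (suc n) k-inv = step-invariant (walk-invariant n k-inv)

    -- On coset-invariant functions the walk is the walk of a cycle, which merely rotates arcs.

    Rotates : Carrier → Set
    Rotates ε = ∀ {k} → Invariant k → ∀ {x y} → y ≋ x ⊕ ε → step k (x , y) ≡ k (x ⊖ ε , x)

    -- The inflow at x is the sum of the two incoming values; subtracting the reversed arc cancels
    -- the one that comes from the coset of y and leaves the one from the opposite side.
    rotates₊ : Rotates 1#
    rotates₊ {k} k-inv {x} {y} p = begin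
      inflow k x - k (y , x)                                   ≡⟨ cong₂ _-_ (inflow-invariant k-inv x) (k-inv p ≋-refl) ⟩
      k (x ⊕ 1# , x) + k (x ⊖ 1# , x) - k (x ⊕ 1# , x)         ≡⟨ solve 2 (λ a b → a :+ b :- a := b) refl (k (x ⊕ 1# , x)) (k (x ⊖ 1# , x)) ⟩
      k (x ⊖ 1# , x)                                           ∎
      where open ≡-Reasoning

    rotates₋ : Rotates (∼ 1#)
    rotates₋ {k} k-inv {x} {y} p = begin
      inflow k x - k (y , x)                                   ≡⟨ cong₂ _-_ (inflow-invariant k-inv x) (k-inv p ≋-refl) ⟩
      k (x ⊕ 1# , x) + k (x ⊖ 1# , x) - k (x ⊖ 1# , x)         ≡⟨ solve 2 (λ a b → a :+ b :- b := a) refl (k (x ⊕ 1# , x)) (k (x ⊖ 1# , x)) ⟩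
      k (x ⊕ 1# , x)                                           ≡⟨ k-inv (≈⇒≋ (+-cong ≈-refl (≈-sym (-‿involutive 1#)))) ≋-refl ⟩
      k (x ⊖ (∼ 1#) , x)                                       ∎
      where open ≡-Reasoning

    back : Carrier → ℕ → Carrier → Carrier
    back ε zero    x = x
    back ε (suc n) x = back ε n (x ⊖ ε)

    walk-back : ∀ {ε} → Rotates ε → ∀ n {k} → Invariant k → ∀ {x y} → y ≋ x ⊕ ε →
                walk (suc n) k (x , y) ≡ k (back ε (suc n) x , back ε n x)
    walk-back rot zero    k-inv p = rot k-inv p
    walk-back rot (suc n) k-inv {x} p =
      trans (rot (walk-invariant (suc n) k-inv) p) (walk-back rot n k-inv (≈⇒≋ (≈-sym (x⊖y⊕y≈x x _))))

    walk-6 : ∀ {ε} → Rotates ε → (∀ x → back ε 6 x ≋ x) → ∀ {k} → Invariant k → ∀ {x y} → y ≋ x ⊕ ε →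
             walk 6 k (x , y) ≡ k (x , y)
    walk-6 {ε} rot six′ k-inv {x} p = trans (walk-back rot 5 k-inv p) (k-inv (six′ x)
      -- For the head: `back ε 6 x` unfolds to `back ε 5 x ⊖ ε`, so `back ε 5 x` is
      -- `back ε 6 x ⊕ ε`, which is congruent to x ⊕ ε and thus to y.
      (≋-trans (≈⇒≋ (≈-sym (x⊖y⊕y≈x (back ε 5 x) ε))) (≋-trans (≋-+ (six′ x) ≋-refl) (≋-sym p))))

    six₋ : ∀ x → back (∼ 1#) 6 x ≋ x
    six₋ x = ≋-trans (≈⇒≋ (l (l (l (l (l (l ≈-refl))))))) (six x)
      where
      l : ∀ {y z} → y ≈ z → y ⊖ (∼ 1#) ≈ z ⊕ 1#
      l p = +-cong p (-‿involutive 1#)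

    six₊ : ∀ x → back 1# 6 x ≋ x
    six₊ x = ≋-trans (≋-sym (six (back 1# 6 x))) (≈⇒≋ (l (l (l (l (l (l ≈-refl)))))))
      where
      l : ∀ {y z} → y ≈ z ⊖ 1# → y ⊕ 1# ≈ z
      l p = ≈-trans (+-cong p ≈-refl) (x⊖y⊕y≈x _ 1#)

    adj⇒≋ : ∀ x y → adj x y ≡ true → y ≋ x ⊕ 1# ⊎ y ≋ x ⊖ 1#
    adj⇒≋ x y p with J (y ⊖ (x ⊕ 1#)) | J (y ⊖ (x ⊖ 1#)) | adj-cosets y x
    ... | true  | _     | _ = inj₁ refl
    ... | false | true  | _ = inj₂ refl
    ... | false | false | e rewrite trans (adj-sym y x) p = contradiction (trans (sym (ℚₚ.*-identityʳ c)) e) c≢0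

    invariant-period : ∀ {k} → Invariant k → walk 6 k ≗ᵃ k
    invariant-period k-inv x y p with adj⇒≋ x y p
    ... | inj₁ q = walk-6 rotates₊ six₊ k-inv q
    ... | inj₂ q = walk-6 rotates₋ six₋ k-inv q

    -- On functions with vanishing coset averages the square of the step has order two.

    Fluctuating : ArcFunction → Set
    Fluctuating h = ∀ x y → avg₂ h (x , y) ≡ 0ℚ

    -- The mirror image of `inflow`, over arcs leaving x. On fluctuating functions a step sends the
    -- outflow to the inflow and the inflow to minus the outflow, a quarter turn; this is the source
    -- of the period 4.
    outflow : ArcFunction → Carrier → ℚ
    outflow h x = avg (λ w → h (x , w)) (x ⊕ 1#) + avg (λ w → h (x , w)) (x ⊖ 1#)

    -- While w runs over the coset of z, the elements w ± 1 stay in the cosets of z ± 1. The mean of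
    -- the inflow is therefore a sum of two means of h over pairs of cosets, and both vanish.
    avg-inflow : ∀ {h} → Fluctuating h → ∀ z → avg (inflow h) z ≡ 0ℚ
    avg-inflow {h} fl z = begin
      avg (inflow h) z
        ≡⟨ avg-cong z (λ w p → trans (inflow≡avg h w) (cong₂ _+_ (avg-resp _ (≋-+ p ≋-refl)) (avg-resp _ (≋-⊖ p ≋-refl)))) ⟩
      avg (λ w → avg (λ v → h (v , w)) (z ⊕ 1#) + avg (λ v → h (v , w)) (z ⊖ 1#)) z
        ≡⟨ avg-+ _ _ z ⟩
      avg (λ w → avg (λ v → h (v , w)) (z ⊕ 1#)) z + avg (λ w → avg (λ v → h (v , w)) (z ⊖ 1#)) z
        ≡⟨ cong₂ _+_ (trans (avg-swap (λ w v → h (v , w)) z (z ⊕ 1#)) (fl (z ⊕ 1#) z))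
                     (trans (avg-swap (λ w v → h (v , w)) z (z ⊖ 1#)) (fl (z ⊖ 1#) z)) ⟩
      0ℚ + 0ℚ ≡⟨ ℚₚ.+-identityˡ 0ℚ ⟩
      0ℚ ∎
      where open ≡-Reasoning

    step-fluctuating : ∀ {h} → Fluctuating h → Fluctuating (step h)
    step-fluctuating {h} fl x y = begin
      avg (λ w → avg (λ v → inflow h w - h (v , w)) y) x
        ≡⟨ avg-cong x (λ w _ → trans (avg-sub _ _ y) (cong (_- avg (λ v → h (v , w)) y) (avg-const (inflow h w) y))) ⟩
      avg (λ w → inflow h w - avg (λ v → h (v , w)) y) x
        ≡⟨ avg-sub _ _ x ⟩
      avg (inflow h) x - avg (λ w → avg (λ v → h (v , w)) y) x
        ≡⟨ cong₂ _-_ (avg-inflow fl x) (trans (avg-swap (λ w v → h (v , w)) x y) (fl y x)) ⟩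
      0ℚ - 0ℚ ≡⟨ refl ⟩
      0ℚ ∎
      where open ≡-Reasoning

    -- By `avg-inflow` the inflow term of the step averages to zero, so only the reversed arcs
    -- contribute.
    inflow-step : ∀ {h} → Fluctuating h → ∀ x → inflow (step h) x ≡ - outflow h x
    inflow-step {h} fl x = trans (inflow≡avg (step h) x) (trans (cong₂ _+_ (part (x ⊕ 1#)) (part (x ⊖ 1#)))
      (solve 2 (λ a b → (con 0ℚ :- a) :+ (con 0ℚ :- b) := :- (a :+ b)) refl (avg (λ w → h (x , w)) (x ⊕ 1#)) (avg (λ w → h (x , w)) (x ⊖ 1#))))
      where
      part : ∀ z → avg (λ w → step h (w , x)) z ≡ 0ℚ - avg (λ w → h (x , w)) z
      part z = trans (avg-sub (inflow h) _ z) (cong (_- avg (λ w → h (x , w)) z) (avg-inflow fl z))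

    -- Along the arcs leaving x the inflow term of the step is constant and enters twice, once per
    -- coset; the reversed arcs remove it once.
    outflow-step : ∀ h x → outflow (step h) x ≡ inflow h x
    outflow-step h x = begin
      outflow (step h) x
        ≡⟨ cong₂ _+_ (part (x ⊕ 1#)) (part (x ⊖ 1#)) ⟩
      (inflow h x - a) + (inflow h x - b)
        ≡⟨ solve 3 (λ i a b → (i :- a) :+ (i :- b) := i :+ (i :- (a :+ b))) refl (inflow h x) a b ⟩
      inflow h x + (inflow h x - (a + b))
        ≡⟨ cong (λ s → inflow h x + (inflow h x - s)) (inflow≡avg h x) ⟨
      inflow h x + (inflow h x - inflow h x)
        ≡⟨ solve 1 (λ i → i :+ (i :- i) := i) refl (inflow h x) ⟩
      inflow h x ∎
      where
      open ≡-Reasoning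
      a = avg (λ w → h (w , x)) (x ⊕ 1#)
      b = avg (λ w → h (w , x)) (x ⊖ 1#)
      part : ∀ z → avg (λ w → step h (x , w)) z ≡ inflow h x - avg (λ w → h (w , x)) z
      part z = trans (avg-sub (λ _ → inflow h x) (λ w → h (w , x)) z) (cong (_- avg (λ w → h (w , x)) z) (avg-const (inflow h x) z))

    step-step : ∀ {h} → Fluctuating h → ∀ x y → step (step h) (x , y) ≡ - outflow h x - (inflow h y - h (x , y))
    step-step {h} fl x y = cong (_- (inflow h y - h (x , y))) (inflow-step fl x)

    -- Two steps subtract from h the outflow at the tail and the inflow at the head. Both quantities
    -- change sign under two steps, so the next two steps add back what was subtracted.
    walk-4 : ∀ {h} → Fluctuating h → ∀ x y → walk 4 h (x , y) ≡ h (x , y)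
    walk-4 {h} fl x y = begin
      walk 4 h (x , y)
        ≡⟨ step-step (step-fluctuating (step-fluctuating fl)) x y ⟩
      - outflow (walk 2 h) x - (inflow (walk 2 h) y - walk 2 h (x , y))
        ≡⟨ cong₂ (λ o i → - o - (i - walk 2 h (x , y)))
             (trans (outflow-step (step h) x) (inflow-step fl x))
             (trans (inflow-step (step-fluctuating fl) y) (cong -_ (outflow-step h y))) ⟩
      - (- outflow h x) - (- inflow h y - walk 2 h (x , y))
        ≡⟨ cong (λ s → - (- outflow h x) - (- inflow h y - s)) (step-step fl x y) ⟩
      - (- outflow h x) - (- inflow h y - (- outflow h x - (inflow h y - h (x , y))))
        ≡⟨ solve 3 (λ o i z → :- (:- o) :- (:- i :- (:- o :- (i :- z))) := z) refl (outflow h x) (inflow h y) (h (x , y)) ⟩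
      h (x , y) ∎
      where open ≡-Reasoning

    walk-fluctuating : ∀ n {h} → Fluctuating h → Fluctuating (walk n h)
    walk-fluctuating zero    fl = fl
    walk-fluctuating (suc n) fl = step-fluctuating (walk-fluctuating n fl)

    blowup-periodic : Periodic
    blowup-periodic = ⇒periodic 12 (ℕ.s≤s ℕ.z≤n) λ g _ x y p →
      let ḡ = avg₂ g
          h : ArcFunction
          h a = g a - avg₂ g a
          ḡ-inv = avg₂-invariant g
          fl : Fluctuating h
          fl u v = fluctuation g u v
      in trans (walk-+ 12 {g} {ḡ} {h} (λ a → solve 2 (λ s t → s := t :+ (s :- t)) refl (g a) (ḡ a)) (x , y))
         (trans (cong₂ _+_
            (trans (invariant-period (walk-invariant 6 ḡ-inv) x y p) (invariant-period ḡ-inv x y p))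
            (trans (walk-4 (walk-fluctuating 8 fl) x y) (trans (walk-4 (walk-fluctuating 4 fl) x y) (walk-4 fl x y))))
          (solve 2 (λ s t → t :+ (s :- t) := s) refl (g (x , y)) (ḡ (x , y))))
      where
      -- `avg₂` is a projection: its values are already constant on pairs of cosets, hence unchanged
      -- by a second averaging.
      fluctuation : ∀ g x y → avg₂ (λ a → g a - avg₂ g a) (x , y) ≡ 0ℚ
      fluctuation g x y = begin
        avg₂ (λ a → g a - avg₂ g a) (x , y)
          ≡⟨ avg-cong x (λ w _ → avg-sub (λ v → g (w , v)) (λ v → avg₂ g (w , v)) y) ⟩
        avg (λ w → avg (λ v → g (w , v)) y - avg (λ v → avg₂ g (w , v)) y) x
          ≡⟨ avg-sub (λ w → avg (λ v → g (w , v)) y) (λ w → avg (λ v → avg₂ g (w , v)) y) x ⟩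
        avg₂ g (x , y) - avg₂ (avg₂ g) (x , y)
          ≡⟨ cong (λ s → avg₂ g (x , y) - s) (avg-inv x (λ w p → avg-inv y (λ v q → avg₂-invariant g p q))) ⟩
        avg₂ g (x , y) - avg₂ g (x , y)
          ≡⟨ ℚₚ.+-inverseʳ (avg₂ g (x , y)) ⟩
        0ℚ ∎
        where open ≡-Reasoning

-- Local rings and products of local rings

dec-sound : ∀ {P : Set} (P? : Dec P) → does P? ≡ true → P
dec-sound (yes p) _ = p

module MaximalIdeals (R : FiniteCommRing) where
  open FiniteCommRing R
    renaming (_+_ to _⊕_; _*_ to _⊗_; _-_ to _⊖_; -_ to ∼_; refl to ≈-refl; sym to ≈-sym; trans to ≈-trans)
    hiding (zero; I)
  open RingSums R

  _⊆_ : (Carrier → Bool) → (Carrier → Bool) → Set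
  I ⊆ J = ∀ x → I x ≡ true → J x ≡ true

  private
    multiple? : ∀ (I : Carrier → Bool) a z → Dec (Any (λ s → I (z ⊖ s ⊗ a) ≡ true) elems)
    multiple? I a z = Any.any? (λ s → I (z ⊖ s ⊗ a) Bool.≟ true) elems

  -- Membership in the ideal I + R a, decided by trying every coefficient s.
  extend : (Carrier → Bool) → Carrier → Carrier → Bool
  extend I a z = does (multiple? I a z)

  extend-mono : ∀ {I J} a → I ⊆ J → extend I a ⊆ extend J a
  extend-mono {I} {J} a I⊆J z p = dec-true (multiple? J a z) (Any.map (λ {s} → I⊆J (z ⊖ s ⊗ a)) (dec-sound (multiple? I a z) p))

  module _ {I : Carrier → Bool} (I-ideal : IsIdeal I) where
    open Cosets R I I-ideal

    extend⁺ : ∀ {a z} s → z ≋ s ⊗ a → extend I a z ≡ true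
    extend⁺ {a} {z} s p = dec-true (multiple? I a z)
      (Any.map (λ s≈s′ → ≋-trans p (≈⇒≋ (*-cong s≈s′ ≈-refl))) (complete s))

    extend⁻ : ∀ {a z} → extend I a z ≡ true → ∃ λ s → z ≋ s ⊗ a
    extend⁻ {a} {z} p = Any.satisfied (dec-sound (multiple? I a z) p)

    extend-ideal : ∀ a → IsIdeal (extend I a)
    extend-ideal a = record
      { resp  = λ x≈y → ⇔→≡ (mk⇔ (respects x≈y) (respects (≈-sym x≈y)))
      ; zero∈ = extend⁺ 0# (≈⇒≋ (≈-sym (zeroˡ a)))
      ; +-cl  = λ x y p q → let s , x≋ = extend⁻ p ; t , y≋ = extend⁻ q in
                extend⁺ (s ⊕ t) (≋-trans (≋-+ x≋ y≋) (≈⇒≋ (≈-sym (distribʳ a s t))))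
      ; *-cl  = λ r x p → let s , x≋ = extend⁻ p in
                extend⁺ (r ⊗ s) (≋-trans (≋-*ˡ r x≋) (≈⇒≋ (≈-sym (*-assoc r s a))))
      }
      where
      respects : ∀ {x y} → x ≈ y → extend I a x ≡ true → extend I a y ≡ true
      respects x≈y p = let s , x≋ = extend⁻ p in extend⁺ s (≋-trans (≈⇒≋ (≈-sym x≈y)) x≋)

    ⊆-extend : ∀ a → I ⊆ extend I a
    ⊆-extend a x x∈ = extend⁺ 0# (≋-trans (∈⇒≋0 x∈) (≈⇒≋ (≈-sym (zeroˡ a))))

    ∈-extend : ∀ a → extend I a a ≡ true
    ∈-extend a = extend⁺ 1# (≈⇒≋ (≈-sym (*-identityˡ a)))

  -- A finite substitute for Zorn's lemma: each listed element is adjoined unless this would produce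
  -- 1. A refusal stays valid because I + R e only grows with I, so the resulting M can be enlarged
  -- by no listed element and remain proper.
  grow : ∀ es I → IsIdeal I → I 1# ≡ false →
         ∃ λ M → IsIdeal M × I ⊆ M × M 1# ≡ false × (∀ {e} → e ∈ es → M e ≡ true ⊎ extend M e 1# ≡ true)
  grow [] I I-ideal proper = I , I-ideal , (λ _ p → p) , proper , λ ()
  grow (e ∷ es) I I-ideal proper with extend I e 1# in eq
  ... | true  = let M , M-ideal , I⊆M , M-proper , max = grow es I I-ideal proper in
    M , M-ideal , I⊆M , M-proper ,
    λ { (here refl) → inj₂ (extend-mono e I⊆M 1# eq) ; (there e∈) → max e∈ }
  ... | false = let M , M-ideal , I′⊆M , M-proper , max = grow es (extend I e) (extend-ideal I-ideal e) eq in
    M , M-ideal , (λ x p → I′⊆M x (⊆-extend I-ideal e x p)) , M-proper ,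
    λ { (here refl) → inj₁ (I′⊆M e (∈-extend I-ideal e)) ; (there e∈) → max e∈ }

  maximal-above : ∀ I → IsIdeal I → I 1# ≡ false → ∃ λ M → IsMaximalIdeal M × I ⊆ M
  maximal-above I I-ideal proper with grow elems I I-ideal proper
  ... | M , M-ideal , I⊆M , M-proper , max = M , record { ideal = M-ideal ; proper = M-proper ; maxl = maxl } , I⊆M
    where
    maxl : ∀ J → IsIdeal J → M ⊆ J → (∀ x → J x ≡ M x) ⊎ J 1# ≡ true
    maxl J J-ideal M⊆J with J 1# in eq
    ... | true  = inj₂ refl
    ... | false = inj₁ λ x → ⇔→≡ (mk⇔ (J⊆M x) (M⊆J x))
      where
      open IsIdeal
      J⊆M : J ⊆ M
      J⊆M x x∈J with find (complete x)
      ... | e , e∈ , x≈e with max e∈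
      ...   | inj₁ e∈M = trans (resp M-ideal x≈e) e∈M
      ...   | inj₂ p   = contradiction (trans (sym 1∈J) eq) true≢false
        where
        module J = Cosets R J J-ideal
        s = proj₁ (extend⁻ M-ideal p)
        1∈J : J 1# ≡ true
        1∈J = trans (J.∈-≋ (M⊆J _ (proj₂ (extend⁻ M-ideal p)))) (*-cl J-ideal s e (trans (sym (resp J-ideal x≈e)) x∈J))

  zero-ideal : IsIdeal (λ z → does (z ≟ 0#))
  zero-ideal = record
    { resp  = λ x≈y → does-cong (≈-trans (≈-sym x≈y)) (≈-trans x≈y)
    ; zero∈ = does-true ≈-refl
    ; +-cl  = λ x y p q → does-true (≈-trans (+-cong (does-sound p) (does-sound q)) (+-identityˡ 0#))
    ; *-cl  = λ r x p → does-true (≈-trans (*-cong ≈-refl (does-sound p)) (zeroʳ r))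
    }

  module _ {M : Carrier → Bool} (unique-maximal : IsUniqueMaximalIdeal M) where
    open IsMaximalIdeal (proj₁ unique-maximal)
    open IsIdeal ideal

    unit⇒∉ : ∀ {x w} → x ⊗ w ≈ 1# → M x ≡ false
    unit⇒∉ {x} {w} e = ¬-not λ x∈ →
      contradiction (trans (sym (trans (sym (resp (≈-trans (*-comm w x) e))) (*-cl w x x∈))) proper) true≢false

    -- The extension of the zero ideal by x is the principal ideal R x. If it contains 1, an inverse
    -- is found; otherwise it lies in a maximal ideal, which by uniqueness is M, although x is not
    -- in M.
    ∉⇒unit : ∀ x → M x ≡ false → ∃ λ w → x ⊗ w ≈ 1#
    ∉⇒unit x x∉ with extend (λ z → does (z ≟ 0#)) x 1# in eq
    ... | true  = let s , p = extend⁻ zero-ideal eq in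
      s , ≈-trans (*-comm x s) (≈-sym (x-y≈0⇒x≈y (does-sound p)))
      where
      x-y≈0⇒x≈y : ∀ {x y} → x ⊖ y ≈ 0# → x ≈ y
      x-y≈0⇒x≈y {x} {y} p = ≈-trans (≈-sym (x⊖y⊕y≈x x y)) (≈-trans (+-cong p ≈-refl) (+-identityˡ y))
    ... | false with maximal-above (extend (λ z → does (z ≟ 0#)) x) (extend-ideal zero-ideal x) eq
    ...   | M′ , M′-maximal , ⊆M′ =
      contradiction (trans (sym (⊆M′ x (∈-extend zero-ideal x))) (trans (proj₂ unique-maximal M′ M′-maximal x) x∉)) true≢false

-- Residue fields of order two and three in terms of cosets

module Residues (R : FiniteCommRing) (M : FiniteCommRing.Carrier R → Bool) (M-ideal : FiniteCommRing.IsIdeal R M)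
                (proper : M (FiniteCommRing.1# R) ≡ false) where
  open FiniteCommRing R
    renaming (_+_ to _⊕_; _*_ to _⊗_; _-_ to _⊖_; -_ to ∼_; refl to ≈-refl; sym to ≈-sym; trans to ≈-trans)
    hiding (zero; I)
  open RingSums R
  open Cosets R M M-ideal
  open IsIdeal M-ideal
  open import Algebra.Properties.Ring ring

  ∉⇒¬∈ : ∀ {x} → M x ≡ false → ¬ M x ≡ true
  ∉⇒¬∈ p q = true≢false (trans (sym q) p)

  1∉ : ¬ M 1# ≡ true
  1∉ = ∉⇒¬∈ proper

  ≋1⇒∉ : ∀ {x} → x ≋ 1# → M x ≡ false
  ≋1⇒∉ p = trans (∈-≋ p) proper

  ≋-1⇒∉ : ∀ {x} → x ≋ ∼ 1# → M x ≡ false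
  ≋-1⇒∉ p = trans (∈-≋ p) (¬-not λ q → 1∉ (trans (sym (resp (-‿involutive 1#))) (neg∈ (∼ 1#) q)))

  x⊖-y≈x⊕y : ∀ x y → x ⊖ (∼ y) ≈ x ⊕ y
  x⊖-y≈x⊕y x y = +-cong ≈-refl (-‿involutive y)

  TwoClasses : Set
  TwoClasses = (∀ x → M x ≡ false → x ≋ 1#) × 1# ≋ ∼ 1#

  -- The last clause keeps the cosets of 1 and -1 apart, which is what makes c = 1 correct in
  -- `three-periodic`.
  ThreeClasses : Set
  ThreeClasses = (∀ x → M x ≡ false → x ≋ 1# ⊎ x ≋ ∼ 1#) × 1# ⊕ 1# ⊕ 1# ≋ 0# × ¬ 1# ≋ ∼ 1#

  module _ {m : ℕ} .{{_ : ℕ.NonZero m}} (iso : ResidueIso M m) where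
    open ResidueIso iso

    f-≋ : ∀ {x y} → x ≋ y → f x ≡ f y
    f-≋ {x} {y} = Equivalence.from (classes x y)

    f-reflects : ∀ {x y} → f x ≡ f y → x ≋ y
    f-reflects {x} {y} = Equivalence.to (classes x y)

    -- The source of f 0# ≡ 0: among the residues modulo 2 or 3 only 0 equals its own double, which
    -- the callers verify by cases.
    f0-idempotent : f 0# ≡ (f 0# ℕ.+ f 0#) ℕ.% m
    f0-idempotent = trans (f-≋ (≈⇒≋ (≈-sym (+-identityˡ 0#)))) (hom-+ 0# 0#)

    f≡0⇒∈ : f 0# ≡ 0 → ∀ {x} → f x ≡ 0 → M x ≡ true
    f≡0⇒∈ f0 p = ≋0⇒∈ (f-reflects (trans p (sym f0)))

  iso₂⇒two : ResidueIso M 2 → TwoClasses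
  iso₂⇒two iso = (λ x x∉ → f-reflects iso (trans (f≡1 x x∉) (sym hom-1))) , trans (resp (x⊖-y≈x⊕y 1# 1#)) 2∈
    where
    open ResidueIso iso
    f0 : f 0# ≡ 0
    f0 with f 0# | f<m 0# | f0-idempotent iso
    ... | 0 | _ | _ = refl
    ... | 1 | _ | ()
    ... | suc (suc _) | ℕ.s≤s (ℕ.s≤s ()) | _
    f≡1 : ∀ x → M x ≡ false → f x ≡ 1
    f≡1 x x∉ with f x in eq | f<m x
    ... | 0 | _ = contradiction (f≡0⇒∈ iso f0 eq) (∉⇒¬∈ x∉)
    ... | 1 | _ = refl
    ... | suc (suc _) | ℕ.s≤s (ℕ.s≤s ())
    2∈ : M (1# ⊕ 1#) ≡ true
    2∈ = f≡0⇒∈ iso f0 (trans (hom-+ 1# 1#) (cong (λ n → (n ℕ.+ n) ℕ.% 2) hom-1))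

  iso₃⇒three : ResidueIso M 3 → ThreeClasses
  iso₃⇒three iso = dichotomy , ∈⇒≋0 3∈ , λ p → case (trans (sym f2) (trans (f-≋ iso (∈⇒≋0 (trans (resp (≈-sym (x⊖-y≈x⊕y 1# 1#))) p))) f0))
    where
    open ResidueIso iso
    case : ¬ 2 ≡ 0
    case ()
    f0 : f 0# ≡ 0
    f0 with f 0# | f<m 0# | f0-idempotent iso
    ... | 0 | _ | _ = refl
    ... | 1 | _ | ()
    ... | 2 | _ | ()
    ... | suc (suc (suc _)) | ℕ.s≤s (ℕ.s≤s (ℕ.s≤s ())) | _
    f2 : f (1# ⊕ 1#) ≡ 2
    f2 = trans (hom-+ 1# 1#) (cong (λ n → (n ℕ.+ n) ℕ.% 3) hom-1)
    3∈ : M (1# ⊕ 1# ⊕ 1#) ≡ true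
    3∈ = f≡0⇒∈ iso f0 (trans (hom-+ (1# ⊕ 1#) 1#) (cong₂ (λ k n → (k ℕ.+ n) ℕ.% 3) f2 hom-1))
    dichotomy : ∀ x → M x ≡ false → x ≋ 1# ⊎ x ≋ ∼ 1#
    dichotomy x x∉ with f x in eq | f<m x
    ... | 0 | _ = contradiction (f≡0⇒∈ iso f0 eq) (∉⇒¬∈ x∉)
    ... | 1 | _ = inj₁ (f-reflects iso (trans eq (sym hom-1)))
    ... | 2 | _ = inj₂ (≋-trans (f-reflects iso (trans eq (sym f2))) (trans (resp (x⊖-y≈x⊕y (1# ⊕ 1#) 1#)) 3∈))
    ... | suc (suc (suc _)) | ℕ.s≤s (ℕ.s≤s (ℕ.s≤s ()))

  SixFold : Set
  SixFold = ∀ x → x ⊕ 1# ⊕ 1# ⊕ 1# ⊕ 1# ⊕ 1# ⊕ 1# ≋ x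

  two⇒six : TwoClasses → SixFold
  two⇒six (_ , 1≋-1) x = ≋-trans (+2 _) (≋-trans (+2 _) (+2 x))
    where
    +2 : ∀ x → x ⊕ 1# ⊕ 1# ≋ x
    +2 x = ≋-trans (≋-+ (≋-+ (≋-refl {x}) 1≋-1) (≋-refl {1#})) (≈⇒≋ (x⊖y⊕y≈x x 1#))

  three⇒six : ThreeClasses → SixFold
  three⇒six (_ , 3≋0 , _) x = ≋-trans (+3 _) (+3 x)
    where
    +3 : ∀ x → x ⊕ 1# ⊕ 1# ⊕ 1# ≋ x
    +3 x = ≋-trans (≈⇒≋ (≈-trans (+-assoc (x ⊕ 1#) 1# 1#) (≈-trans (+-assoc x 1# (1# ⊕ 1#)) (+-cong ≈-refl (≈-sym (+-assoc 1# 1# 1#))))))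
             (≋-trans (≋-+ (≋-refl {x}) 3≋0) (≈⇒≋ (+-identityʳ x)))

module Local (R : FiniteCommRing) (M : FiniteCommRing.Carrier R → Bool)
             (M-unique : FiniteCommRing.IsUniqueMaximalIdeal R M) where
  open FiniteCommRing R public
    renaming (_+_ to _⊕_; _*_ to _⊗_; _-_ to _⊖_; -_ to ∼_; refl to ≈-refl; sym to ≈-sym; trans to ≈-trans)
    hiding (zero; I)
  open import Algebra.Properties.Ring ring public
  open RingSums R public
  open FiniteCommRing.IsMaximalIdeal (proj₁ M-unique) using (ideal; proper) public
  open FiniteCommRing.IsIdeal ideal using (resp; zero∈; +-cl; *-cl) public
  open Cosets R M ideal public
  open Residues R M ideal proper public

-- From the local factors to their product

module LocalProduct
  (R : FiniteCommRing) {s : ℕ} (Rs : Fin s → FiniteCommRing)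
  (Ms : (i : Fin s) → FiniteCommRing.Carrier (Rs i) → Bool)
  (Ms-unique : ∀ i → FiniteCommRing.IsUniqueMaximalIdeal (Rs i) (Ms i))
  (iso : ProductIso R Rs) where
  open FiniteCommRing R
    renaming (_+_ to _⊕_; _*_ to _⊗_; _-_ to _⊖_; -_ to ∼_; refl to ≈-refl; sym to ≈-sym; trans to ≈-trans)
    hiding (zero; I)
  open RingSums R
  open ProductIso iso using (φ; hom-+; hom-*; hom-1; inj; surj) renaming (cong to φ-cong) public
  module L (i : Fin s) = Local (Rs i) (Ms i) (Ms-unique i)

  φ-0 : ∀ i → L._≈_ i (φ 0# i) (L.0# i)
  φ-0 i = L.x+x≈x⇒x≈0 i _ (L.≈-trans i (L.≈-sym i (hom-+ 0# 0# i)) (φ-cong (+-identityˡ 0#) i))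

  φ-neg : ∀ x i → L._≈_ i (φ (∼ x) i) (L.∼_ i (φ x i))
  φ-neg x i = L.+-inverseˡ-unique i _ _
    (L.≈-trans i (L.≈-sym i (hom-+ (∼ x) x i)) (L.≈-trans i (φ-cong (-‿inverseˡ x) i) (φ-0 i)))

  φ-⊖ : ∀ x y i → L._≈_ i (φ (x ⊖ y) i) (L._⊖_ i (φ x i) (φ y i))
  φ-⊖ x y i = L.≈-trans i (hom-+ x (∼ y) i) (L.+-cong i (L.≈-refl i) (φ-neg y i))

  unit⇒∉Ms : ∀ x → isUnit x ≡ true → ∀ i → Ms i (φ x i) ≡ false
  unit⇒∉Ms x p i = let w , e = isUnit-sound x p in
    MaximalIdeals.unit⇒∉ (Rs i) (Ms-unique i)
      (L.≈-trans i (L.≈-sym i (hom-* x w i)) (L.≈-trans i (φ-cong e i) (hom-1 i)))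

  ∉Ms⇒unit : ∀ x → (∀ i → Ms i (φ x i) ≡ false) → isUnit x ≡ true
  ∉Ms⇒unit x x∉ = isUnit-complete x w (inj (x ⊗ w) 1# λ i →
    L.≈-trans i (hom-* x w i) (L.≈-trans i (L.*-cong i (L.≈-refl i) (proj₂ preimage i))
      (L.≈-trans i (proj₂ (inverse i)) (L.≈-sym i (hom-1 i)))))
    where
    inverse : ∀ i → ∃ λ v → L._≈_ i (L._⊗_ i (φ x i) v) (L.1# i)
    inverse i = MaximalIdeals.∉⇒unit (Rs i) (Ms-unique i) (φ x i) (x∉ i)
    preimage = surj (λ i → proj₁ (inverse i))
    w = proj₁ preimage

  adj⇒∉ : ∀ u v → adj u v ≡ true → ∀ i → Ms i (L._⊖_ i (φ u i) (φ v i)) ≡ false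
  adj⇒∉ u v p i = trans (sym (L.resp i (φ-⊖ u v i))) (unit⇒∉Ms (u ⊖ v) (trans (sym (adj≡isUnit u v)) p) i)

  ∉⇒adj : ∀ u v → (∀ i → Ms i (L._⊖_ i (φ u i) (φ v i)) ≡ false) → adj u v ≡ true
  ∉⇒adj u v h = trans (adj≡isUnit u v) (∉Ms⇒unit (u ⊖ v) (λ i → trans (L.resp i (φ-⊖ u v i)) (h i)))

  private
    J? : ∀ x → Dec (∀ i → Ms i (φ x i) ≡ true)
    J? x = all? (λ i → Ms i (φ x i) Bool.≟ true)

  J : Carrier → Bool
  J x = does (J? x)

  J⁺ : ∀ {x} → (∀ i → Ms i (φ x i) ≡ true) → J x ≡ true
  J⁺ {x} = dec-true (J? x)

  J⁻ : ∀ {x} → J x ≡ true → ∀ i → Ms i (φ x i) ≡ true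
  J⁻ {x} = dec-sound (J? x)

  J-ideal : IsIdeal J
  J-ideal = record
    { resp  = λ x≈y → ⇔→≡ (mk⇔ (respects x≈y) (respects (≈-sym x≈y)))
    ; zero∈ = J⁺ λ i → trans (L.resp i (φ-0 i)) (L.zero∈ i)
    ; +-cl  = λ x y p q → J⁺ λ i → trans (L.resp i (hom-+ x y i)) (L.+-cl i _ _ (J⁻ p i) (J⁻ q i))
    ; *-cl  = λ r x p → J⁺ λ i → trans (L.resp i (hom-* r x i)) (L.*-cl i _ _ (J⁻ p i))
    }
    where
    respects : ∀ {x y} → x ≈ y → J x ≡ true → J y ≡ true
    respects x≈y p = J⁺ λ i → trans (sym (L.resp i (φ-cong x≈y i))) (J⁻ p i)

  open Cosets R J J-ideal using (_≋_)

  ≋⁺ : ∀ {x y} → (∀ i → L._≋_ i (φ x i) (φ y i)) → x ≋ y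
  ≋⁺ {x} {y} h = J⁺ λ i → trans (L.resp i (φ-⊖ x y i)) (h i)

  ≋⁻ : ∀ {x y} → x ≋ y → ∀ i → L._≋_ i (φ x i) (φ y i)
  ≋⁻ {x} {y} p i = trans (sym (L.resp i (φ-⊖ x y i))) (J⁻ p i)

  φ-+1 : ∀ x i → L._≈_ i (φ (x ⊕ 1#) i) (L._⊕_ i (φ x i) (L.1# i))
  φ-+1 x i = L.≈-trans i (hom-+ x 1# i) (L.+-cong i (L.≈-refl i) (hom-1 i))

  φ-−1 : ∀ x i → L._≈_ i (φ (x ⊖ 1#) i) (L._⊖_ i (φ x i) (L.1# i))
  φ-−1 x i = L.≈-trans i (φ-⊖ x 1# i) (L.⊖-cong i (L.≈-refl i) (hom-1 i))

  six⁺ : (∀ i → L.SixFold i) → ∀ x → x ⊕ 1# ⊕ 1# ⊕ 1# ⊕ 1# ⊕ 1# ⊕ 1# ≋ x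
  six⁺ h x = ≋⁺ λ i → L.≋-trans i (L.≈⇒≋ i (l i (l i (l i (l i (l i (φ-+1 x i))))))) (h i (φ x i))
    where
    l : ∀ i {y z} → L._≈_ i (φ y i) z → L._≈_ i (φ (y ⊕ 1#) i) (L._⊕_ i z (L.1# i))
    l i {y} p = L.≈-trans i (φ-+1 y i) (L.+-cong i p (L.≈-refl i))

  difference : ∀ i {a b c} → L._≋_ i (L._⊖_ i a b) c → L._≋_ i a (L._⊕_ i b c)
  difference i {a} {b} {c} p = L.≋-trans i (L.≈⇒≋ i (L.≈-sym i (L.x⊖y⊕y≈x i a b)))
    (L.≋-trans i (L.≋-+ i p (L.≋-refl i)) (L.≈⇒≋ i (L.+-comm i c b)))

  difference⁻ : ∀ i {a b c} → L._≋_ i a (L._⊕_ i b c) → L._≋_ i (L._⊖_ i a b) c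
  difference⁻ i {a} {b} {c} p = L.≋-trans i (L.≋-⊖ i p (L.≋-refl i))
    (L.≈⇒≋ i (L.≈-trans i (L.+-cong i (L.+-comm i b c) (L.≈-refl i)) (L.x⊕y⊖y≈x i c b)))

  near₊⁺ : ∀ {w x} → (∀ i → L._≋_ i (L._⊖_ i (φ w i) (φ x i)) (L.1# i)) → w ≋ x ⊕ 1#
  near₊⁺ {w} {x} h = ≋⁺ λ i → L.≋-trans i (difference i (h i)) (L.≈⇒≋ i (L.≈-sym i (φ-+1 x i)))

  near₋⁺ : ∀ {w x} → (∀ i → L._≋_ i (L._⊖_ i (φ w i) (φ x i)) (L.∼_ i (L.1# i))) → w ≋ x ⊖ 1#
  near₋⁺ {w} {x} h = ≋⁺ λ i → L.≋-trans i (difference i (h i)) (L.≈⇒≋ i (L.≈-sym i (φ-−1 x i)))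

  near₊⁻ : ∀ {w x} → w ≋ x ⊕ 1# → ∀ i → L._≋_ i (L._⊖_ i (φ w i) (φ x i)) (L.1# i)
  near₊⁻ {w} {x} p i = difference⁻ i (L.≋-trans i (≋⁻ p i) (L.≈⇒≋ i (φ-+1 x i)))

  near₋⁻ : ∀ {w x} → w ≋ x ⊖ 1# → ∀ i → L._≋_ i (L._⊖_ i (φ w i) (φ x i)) (L.∼_ i (L.1# i))
  near₋⁻ {w} {x} p i = difference⁻ i (L.≋-trans i (≋⁻ p i) (L.≈⇒≋ i (φ-−1 x i)))

  near₊⇒adj : ∀ {w x} → w ≋ x ⊕ 1# → adj w x ≡ true
  near₊⇒adj {w} {x} p = ∉⇒adj w x λ i → L.≋1⇒∉ i (near₊⁻ p i)

  near₋⇒adj : ∀ {w x} → w ≋ x ⊖ 1# → adj w x ≡ true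
  near₋⇒adj {w} {x} p = ∉⇒adj w x λ i → L.≋-1⇒∉ i (near₋⁻ p i)

  two-periodic : (∀ i → L.TwoClasses i) → Periodic
  two-periodic two = CycleBlowup.blowup-periodic R J J-ideal 2ℚ (λ ()) adj-cosets (six⁺ λ i → L.two⇒six i (two i))
    where
    adj-cosets : ∀ w x → 2ℚ * ind (adj w x) ≡ ind (J (w ⊖ (x ⊕ 1#))) + ind (J (w ⊖ (x ⊖ 1#)))
    adj-cosets w x
      -- Since 1 ≋ -1 in every factor, each of the two coset indicators equals the adjacency
      -- indicator; this is the case c = 2.
      rewrite ⇔→≡ (mk⇔ (near₊⇒adj {w} {x}) (λ p → near₊⁺ (λ i → proj₁ (two i) _ (adj⇒∉ w x p i))))
            | ⇔→≡ (mk⇔ (near₋⇒adj {w} {x}) (λ p → near₋⁺ (λ i → L.≋-trans i (proj₁ (two i) _ (adj⇒∉ w x p i)) (proj₂ (two i)))))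
      with adj w x
    ... | true  = refl
    ... | false = refl

  -- Only factor j distinguishes 1 from -1. The sign found there decides between the cosets of x + 1
  -- and x - 1, and every other factor agrees with either sign.
  three-periodic : ∀ j → L.ThreeClasses j → (∀ i → i ≢ j → L.TwoClasses i) → Periodic
  three-periodic j (dich , 3≋0 , 1≋̸-1) two = CycleBlowup.blowup-periodic R J J-ideal 1ℚ (λ ()) adj-cosets (six⁺ six)
    where
    six : ∀ i → L.SixFold i
    six i with i Fin.≟ j
    ... | yes refl = L.three⇒six j (dich , 3≋0 , 1≋̸-1)
    ... | no  i≢j  = L.two⇒six i (two i i≢j)
    toward : ∀ w x → adj w x ≡ true → w ≋ x ⊕ 1# ⊎ w ≋ x ⊖ 1#
    toward w x p with dich _ (adj⇒∉ w x p j)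
    ... | inj₁ q = inj₁ (near₊⁺ near)
      where
      near : ∀ i → L._≋_ i (L._⊖_ i (φ w i) (φ x i)) (L.1# i)
      near i with i Fin.≟ j
      ... | yes refl = q
      ... | no  i≢j  = proj₁ (two i i≢j) _ (adj⇒∉ w x p i)
    ... | inj₂ q = inj₂ (near₋⁺ near)
      where
      near : ∀ i → L._≋_ i (L._⊖_ i (φ w i) (φ x i)) (L.∼_ i (L.1# i))
      near i with i Fin.≟ j
      ... | yes refl = q
      ... | no  i≢j  = L.≋-trans i (proj₁ (two i i≢j) _ (adj⇒∉ w x p i)) (proj₂ (two i i≢j))
    adj-cosets : ∀ w x → 1ℚ * ind (adj w x) ≡ ind (J (w ⊖ (x ⊕ 1#))) + ind (J (w ⊖ (x ⊖ 1#)))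
    adj-cosets w x with J (w ⊖ (x ⊕ 1#)) in e₊ | J (w ⊖ (x ⊖ 1#)) in e₋ | adj w x in e
    ... | true  | true  | _     = contradiction (L.≋-trans j (L.≋-sym j (near₊⁻ e₊ j)) (near₋⁻ e₋ j)) 1≋̸-1
    ... | true  | false | true  = refl
    ... | true  | false | false = contradiction (trans (sym (near₊⇒adj e₊)) e) true≢false
    ... | false | true  | true  = refl
    ... | false | true  | false = contradiction (trans (sym (near₋⇒adj e₋)) e) true≢false
    ... | false | false | false = refl
    ... | false | false | true  with toward w x e
    ...   | inj₁ p = contradiction (trans (sym p) e₊) true≢false
    ...   | inj₂ p = contradiction (trans (sym p) e₋) true≢false

-- Rational zeros of Chebyshev polynomials

4ℚ : ℚ
4ℚ = 2ℚ * 2ℚ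

-- Chebyshev polynomials of the second kind, U_{n-1}(θ/2).
cheb : ℚ → ℕ → ℚ
cheb θ zero          = 0ℚ
cheb θ (suc zero)    = 1ℚ
cheb θ (suc (suc n)) = θ * cheb θ (suc n) - cheb θ n

-- Integers inside ℚ, written as differences of naturals so that a divisibility can be pulled back
-- to ℕ by moving the negative part across and applying `ι-injective`.
Integral : ℚ → Set
Integral q = ∃ λ m → ∃ λ n → q ≡ ι m - ι n

pow : ℚ → ℕ → ℚ
pow q zero    = 1ℚ
pow q (suc n) = q * pow q n

integral-ι : ∀ n → Integral (ι n)
integral-ι n = n , 0 , sym (ℚₚ.+-identityʳ (ι n))

integral-sub : ∀ {p q} → Integral p → Integral q → Integral (p - q)
integral-sub (m , n , refl) (m′ , n′ , refl) = m ℕ.+ n′ , n ℕ.+ m′ ,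
  trans (solve 4 (λ a b c d → (a :- b) :- (c :- d) := (a :+ d) :- (b :+ c)) refl (ι m) (ι n) (ι m′) (ι n′))
        (sym (cong₂ _-_ (ι-+ m n′) (ι-+ n m′)))

integral-* : ∀ {p q} → Integral p → Integral q → Integral (p * q)
integral-* (m , n , refl) (m′ , n′ , refl) = m ℕ.* m′ ℕ.+ n ℕ.* n′ , m ℕ.* n′ ℕ.+ n ℕ.* m′ ,
  trans (solve 4 (λ a b c d → (a :- b) :* (c :- d) := (a :* c :+ b :* d) :- (a :* d :+ b :* c)) refl (ι m) (ι n) (ι m′) (ι n′))
        (sym (cong₂ _-_ (trans (ι-+ (m ℕ.* m′) (n ℕ.* n′)) (cong₂ _+_ (ι-* m m′) (ι-* n n′)))
                        (trans (ι-+ (m ℕ.* n′) (n ℕ.* m′)) (cong₂ _+_ (ι-* m n′) (ι-* n m′)))))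

integral-neg : ∀ {p} → Integral p → Integral (- p)
integral-neg {p} p∈ = subst Integral (ℚₚ.+-identityˡ (- p)) (integral-sub (integral-ι 0) p∈)

integral-+ : ∀ {p q} → Integral p → Integral q → Integral (p + q)
integral-+ {p} {q} p∈ q∈ = subst Integral (solve 2 (λ a b → a :- (:- b) := a :+ b) refl p q) (integral-sub p∈ (integral-neg q∈))

integral-pow : ∀ {p} n → Integral p → Integral (pow p n)
integral-pow zero    p∈ = integral-ι 1
integral-pow (suc n) p∈ = integral-* p∈ (integral-pow n p∈)

pow-* : ∀ p q n → pow (p * q) n ≡ pow p n * pow q n
pow-* p q zero    = refl
pow-* p q (suc n) = trans (cong (p * q *_) (pow-* p q n))
  (solve 4 (λ a b c d → a :* b :* (c :* d) := a :* c :* (b :* d)) refl p q (pow p n) (pow q n))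

pow-ι : ∀ a n → pow (ι a) n ≡ ι (a ℕ.^ n)
pow-ι a zero    = refl
pow-ι a (suc n) = trans (cong (ι a *_) (pow-ι a n)) (sym (ι-* a (a ℕ.^ n)))

pow-1 : ∀ n → pow 1ℚ n ≡ 1ℚ
pow-1 zero    = refl
pow-1 (suc n) = trans (ℚₚ.*-identityˡ _) (pow-1 n)

coprime-∣-pow : ∀ {a b} → Coprime b a → ∀ n → b ∣ a ℕ.^ n → b ≡ 1
coprime-∣-pow c zero    d = ∣1⇒≡1 d
coprime-∣-pow c (suc n) d = coprime-∣-pow c n (coprime-divisor c d)

-- Clearing denominators in U_{n}(θ/2) at θ = Q/P leaves Q^n modulo P.
cheb-numerator : ∀ {θ P Q} → Integral P → Integral Q → θ * P ≡ Q →
  ∀ n → ∃ λ z → Integral z × pow P n * cheb θ (suc n) ≡ pow Q n + P * z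
cheb-numerator {θ} {P} {Q} P∈ Q∈ θP≡Q zero = 0ℚ , integral-ι 0 , solve 1 (λ p → con 1ℚ :* con 1ℚ := con 1ℚ :+ p :* con 0ℚ) refl P
cheb-numerator {θ} {P} {Q} P∈ Q∈ θP≡Q (suc zero) = 0ℚ , integral-ι 0 ,
  trans (solve 2 (λ t p → p :* con 1ℚ :* (t :* con 1ℚ :- con 0ℚ) := t :* p) refl θ P)
    (trans θP≡Q (solve 2 (λ p q → q := q :* con 1ℚ :+ p :* con 0ℚ) refl P Q))
cheb-numerator {θ} {P} {Q} P∈ Q∈ θP≡Q (suc (suc n)) =
  let z , z∈ , e = cheb-numerator {θ} P∈ Q∈ θP≡Q n
      z′ , z′∈ , e′ = cheb-numerator {θ} P∈ Q∈ θP≡Q (suc n)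
      T = pow Q n + P * z
  -- Multiplying the recurrence by the next power of P gives Q (Q^(n+1) + P z′) - P² T; apart from
  -- Q^(n+2) every term carries a factor P, and this witness is the cofactor.
  in Q * z′ - P * T
   , integral-sub (integral-* Q∈ z′∈) (integral-* P∈ (integral-+ (integral-pow n Q∈) (integral-* P∈ z∈)))
   , (begin
  P * (P * pow P n) * (θ * cheb θ (suc (suc n)) - cheb θ (suc n))
    ≡⟨ solve 5 (λ p w t c₁ c₀ → p :* (p :* w) :* (t :* c₁ :- c₀) := t :* p :* (p :* w :* c₁) :- p :* p :* (w :* c₀)) refl
         P (pow P n) θ (cheb θ (suc (suc n))) (cheb θ (suc n)) ⟩
  θ * P * (P * pow P n * cheb θ (suc (suc n))) - P * P * (pow P n * cheb θ (suc n))
    ≡⟨ cong₂ _-_ (cong₂ _*_ θP≡Q e′) (cong (P * P *_) e) ⟩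
  Q * (Q * pow Q n + P * z′) - P * P * T
    ≡⟨ solve 5 (λ p q w z′ t → q :* (q :* w :+ p :* z′) :- p :* p :* t := q :* (q :* w) :+ p :* (q :* z′ :- p :* t)) refl
         P Q (pow Q n) z′ T ⟩
  Q * (Q * pow Q n) + P * (Q * z′ - P * T) ∎)
  where open ≡-Reasoning

-- The rational root theorem for θ = εa/b in lowest terms, with ε a sign so that a and b are
-- naturals. The polynomial is monic of degree n, so at a root b divides a^n, and coprimality leaves
-- b = 1.
cheb-root-denominator : ∀ {θ ε} a b → Coprime b a → Integral ε → ε * ε ≡ 1ℚ → θ * ι b ≡ ε * ι a →
  ∀ n → cheb θ (suc n) ≡ 0ℚ → b ≡ 1
cheb-root-denominator {θ} {ε} a b coprime ε∈ ε²≡1 θb≡εa n root =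
  coprime-∣-pow coprime n (divides-from (integral-* (integral-neg (integral-pow n ε∈)) z∈))
  where
  open ≡-Reasoning
  Q = ε * ι a
  numerator = cheb-numerator {θ} (integral-ι b) (integral-* ε∈ (integral-ι a)) θb≡εa n
  z = proj₁ numerator
  z∈ = proj₁ (proj₂ numerator)
  Q^n+bz≡0 : pow Q n + ι b * z ≡ 0ℚ
  Q^n+bz≡0 = trans (sym (proj₂ (proj₂ numerator))) (trans (cong (pow (ι b) n *_) root) (ℚₚ.*-zeroʳ (pow (ι b) n)))
  a^n≡bw : ι (a ℕ.^ n) ≡ ι b * (- pow ε n * z)
  a^n≡bw = begin
    ι (a ℕ.^ n)
      ≡⟨ trans (sym (pow-ι a n)) (sym (ℚₚ.*-identityˡ (pow (ι a) n))) ⟩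
    1ℚ * pow (ι a) n
      ≡⟨ cong (_* pow (ι a) n) (trans (sym (pow-1 n)) (trans (cong (λ e → pow e n) (sym ε²≡1)) (pow-* ε ε n))) ⟩
    pow ε n * pow ε n * pow (ι a) n
      -- Multiplication by ε^n, whose square is 1, turns the numerator Q^n = ε^n a^n into the
      -- natural number a^n.
      ≡⟨ solve 4 (λ e w b z → e :* e :* w := e :* (e :* w :+ b :* z) :+ b :* (:- e :* z)) refl (pow ε n) (pow (ι a) n) (ι b) z ⟩
    pow ε n * (pow ε n * pow (ι a) n + ι b * z) + ι b * (- pow ε n * z)
      ≡⟨ cong (λ s → pow ε n * (s + ι b * z) + ι b * (- pow ε n * z)) (pow-* ε (ι a) n) ⟨
    pow ε n * (pow Q n + ι b * z) + ι b * (- pow ε n * z)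
      ≡⟨ cong (λ s → pow ε n * s + ι b * (- pow ε n * z)) Q^n+bz≡0 ⟩
    pow ε n * 0ℚ + ι b * (- pow ε n * z)
      ≡⟨ solve 2 (λ e w → e :* con 0ℚ :+ w := w) refl (pow ε n) (ι b * (- pow ε n * z)) ⟩
    ι b * (- pow ε n * z) ∎
  divides-from : Integral (- pow ε n * z) → b ∣ a ℕ.^ n
  divides-from (p , q , e) = ∣-difference (ι-injective _ _ (begin
    ι (a ℕ.^ n ℕ.+ b ℕ.* q)     ≡⟨ ι-+ (a ℕ.^ n) (b ℕ.* q) ⟩
    ι (a ℕ.^ n) + ι (b ℕ.* q)   ≡⟨ cong₂ _+_ (trans a^n≡bw (cong (ι b *_) e)) (ι-* b q) ⟩
    ι b * (ι p - ι q) + ι b * ι q ≡⟨ solve 3 (λ b p q → b :* (p :- q) :+ b :* q := b :* p) refl (ι b) (ι p) (ι q) ⟩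
    ι b * ι p                   ≡⟨ ι-* b p ⟨
    ι (b ℕ.* p)                 ∎))
    where
    ∣-difference : a ℕ.^ n ℕ.+ b ℕ.* q ≡ b ℕ.* p → b ∣ a ℕ.^ n
    ∣-difference e = ∣m+n∣m⇒∣n {m = b ℕ.* q} (subst (b ∣_) (trans (sym e) (ℕₚ.+-comm (a ℕ.^ n) (b ℕ.* q))) (m∣m*n p)) (m∣m*n q)

-- Here θ = ±A/N. If A < N, then θ² = 4 would give 4N² = A² < N², so the Chebyshev factor must
-- vanish. The reduced denominator N / gcd A N is then 1, hence N divides A, which is positive.
cheb-root-bound : ∀ {θ ε} A N → A ≢ 0 → Integral ε → ε * ε ≡ 1ℚ → θ * ι N ≡ ε * ι A →
  ∀ n → cheb θ (suc n) * (4ℚ - θ * θ) ≡ 0ℚ → N ℕ.≤ A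
cheb-root-bound {θ} {ε} A N A≢0 ε∈ ε²≡1 θN≡εA n root with N ℕ.≤? A
... | yes N≤A = N≤A
... | no  N≰A = subst (ℕ._≤ A) g≡N (∣⇒≤ {{ℕ.≢-nonZero A≢0}} (gcd[m,n]∣m A N))
  where
  open ≡-Reasoning
  A<N = ℕₚ.≰⇒> N≰A
  g = gcd A N
  g≢0 : g ≢ 0
  g≢0 e = A≢0 (gcd[m,n]≡0⇒m≡0 e)
  instance g-nonZero = ℕ.≢-nonZero g≢0
  a = A ℕ./ g
  b = N ℕ./ g
  a*g≡A : a ℕ.* g ≡ A
  a*g≡A = m/n*n≡m (gcd[m,n]∣m A N)
  b*g≡N : b ℕ.* g ≡ N
  b*g≡N = m/n*n≡m (gcd[m,n]∣n A N)
  θ²≢4 : 4ℚ - θ * θ ≢ 0ℚ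
  θ²≢4 e = ℕₚ.<-irrefl (sym eq) (ℕₚ.<-≤-trans (ℕₚ.*-mono-< A<N A<N) (ℕₚ.m≤m+n (N ℕ.* N) _))
    where
    eq : 4 ℕ.* (N ℕ.* N) ≡ A ℕ.* A
    eq = ι-injective _ _ (begin
      ι (4 ℕ.* (N ℕ.* N))        ≡⟨ trans (ι-* 4 (N ℕ.* N)) (cong (ι 4 *_) (ι-* N N)) ⟩
      4ℚ * (ι N * ι N)           ≡⟨ solve 3 (λ f t w → f :* (w :* w) := (f :- t :* t) :* (w :* w) :+ t :* w :* (t :* w)) refl 4ℚ θ (ι N) ⟩
      (4ℚ - θ * θ) * (ι N * ι N) + θ * ι N * (θ * ι N)
        ≡⟨ cong₂ _+_ (trans (cong (_* (ι N * ι N)) e) (ℚₚ.*-zeroˡ (ι N * ι N))) (cong₂ _*_ θN≡εA θN≡εA) ⟩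
      0ℚ + ε * ι A * (ε * ι A)   ≡⟨ solve 2 (λ e a → con 0ℚ :+ e :* a :* (e :* a) := e :* e :* (a :* a)) refl ε (ι A) ⟩
      ε * ε * (ι A * ι A)        ≡⟨ trans (cong (_* (ι A * ι A)) ε²≡1) (ℚₚ.*-identityˡ _) ⟩
      ι A * ι A                  ≡⟨ ι-* A A ⟨
      ι (A ℕ.* A)                ∎)
  θb≡εa : θ * ι b ≡ ε * ι a
  θb≡εa = x-y≡0⇒x≡y (*-cancelˡ-≡0 (ι g) (ι≢0 g g≢0) (begin
    ι g * (θ * ι b - ε * ι a)
      ≡⟨ solve 5 (λ g t b e a → g :* (t :* b :- e :* a) := t :* (b :* g) :- e :* (a :* g)) refl (ι g) θ (ι b) ε (ι a) ⟩
    θ * (ι b * ι g) - ε * (ι a * ι g)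
      ≡⟨ cong₂ (λ s t → θ * s - ε * t) (trans (sym (ι-* b g)) (cong ι b*g≡N)) (trans (sym (ι-* a g)) (cong ι a*g≡A)) ⟩
    θ * ι N - ε * ι A
      ≡⟨ cong (_- ε * ι A) θN≡εA ⟩
    ε * ι A - ε * ι A
      ≡⟨ ℚₚ.+-inverseʳ (ε * ι A) ⟩
    0ℚ ∎))
    where
    x-y≡0⇒x≡y : ∀ {x y} → x - y ≡ 0ℚ → x ≡ y
    x-y≡0⇒x≡y {x} {y} e = trans (solve 2 (λ x y → x := (x :- y) :+ y) refl x y) (trans (cong (_+ y) e) (ℚₚ.+-identityˡ y))
  b≡1 : b ≡ 1
  b≡1 = cheb-root-denominator {θ} a b (Coprimality.sym (coprime-/gcd A N)) ε∈ ε²≡1 θb≡εa n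
    (*-cancelˡ-≡0 (4ℚ - θ * θ) θ²≢4 (trans (ℚₚ.*-comm _ (cheb θ (suc n))) root))
  g≡N : g ≡ N
  g≡N = trans (sym (ℕₚ.*-identityˡ g)) (trans (cong (ℕ._* g) (sym b≡1)) b*g≡N)

-- Eigenfunctions of the unitary Cayley graph

∏ : ∀ {s} → (Fin s → ℚ) → ℚ
∏ {zero}  f = 1ℚ
∏ {suc s} f = f zero * ∏ (λ i → f (suc i))

∏-cong : ∀ {s} {f g : Fin s → ℚ} → (∀ i → f i ≡ g i) → ∏ f ≡ ∏ g
∏-cong {zero}  h = refl
∏-cong {suc s} h = cong₂ _*_ (h zero) (∏-cong (λ i → h (suc i)))

∏-* : ∀ {s} (f g : Fin s → ℚ) → ∏ (λ i → f i * g i) ≡ ∏ f * ∏ g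
∏-* {zero}  f g = refl
∏-* {suc s} f g = trans (cong (f zero * g zero *_) (∏-* (λ i → f (suc i)) (λ i → g (suc i))))
  (solve 4 (λ a b c d → a :* b :* (c :* d) := a :* c :* (b :* d)) refl (f zero) (g zero) (∏ (λ i → f (suc i))) (∏ (λ i → g (suc i))))

∏ℕ : ∀ {s} → (Fin s → ℕ) → ℕ
∏ℕ {zero}  f = 1
∏ℕ {suc s} f = f zero ℕ.* ∏ℕ (λ i → f (suc i))

∏-ι : ∀ {s} (f : Fin s → ℕ) → ∏ (λ i → ι (f i)) ≡ ι (∏ℕ f)
∏-ι {zero}  f = refl
∏-ι {suc s} f = trans (cong (ι (f zero) *_) (∏-ι (λ i → f (suc i)))) (sym (ι-* (f zero) _))

sign : ℕ → ℚ
sign zero    = 1ℚ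
sign (suc n) = - sign n

sign² : ∀ n → sign n * sign n ≡ 1ℚ
sign² zero    = refl
sign² (suc n) = trans (solve 1 (λ a → :- a :* :- a := a :* a) refl (sign n)) (sign² n)

integral-sign : ∀ n → Integral (sign n)
integral-sign zero    = integral-ι 1
integral-sign (suc n) = integral-neg (integral-sign n)

∏-neg : ∀ {s} (f : Fin s → ℚ) → ∏ (λ i → - f i) ≡ sign s * ∏ f
∏-neg {zero}  f = refl
∏-neg {suc s} f = trans (cong (- f zero *_) (∏-neg (λ i → f (suc i))))
  (solve 3 (λ a b c → :- a :* (b :* c) := :- b :* (a :* c)) refl (f zero) (sign s) (∏ (λ i → f (suc i))))

allᵇ : ∀ {s} → (Fin s → Bool) → Bool
allᵇ {zero}  b = true
allᵇ {suc s} b = b zero ∧ allᵇ (λ i → b (suc i))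

∏-ind : ∀ {s} (b : Fin s → Bool) → ∏ (λ i → ind (b i)) ≡ ind (allᵇ b)
∏-ind {zero}  b = refl
∏-ind {suc s} b = trans (cong (ind (b zero) *_) (∏-ind (λ i → b (suc i)))) (sym (ind-∧ (b zero) _))

allᵇ⁺ : ∀ {s} (b : Fin s → Bool) → (∀ i → b i ≡ true) → allᵇ b ≡ true
allᵇ⁺ {zero}  b h = refl
allᵇ⁺ {suc s} b h rewrite h zero = allᵇ⁺ (λ i → b (suc i)) (λ i → h (suc i))

allᵇ⁻ : ∀ {s} (b : Fin s → Bool) → allᵇ b ≡ true → ∀ i → b i ≡ true
allᵇ⁻ {suc s} b p i with b zero in eq
allᵇ⁻ {suc s} b p zero    | true = eq
allᵇ⁻ {suc s} b p (suc i) | true = allᵇ⁻ (λ i → b (suc i)) p i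

Tuple : ∀ {s} → (Fin s → FiniteCommRing) → Set
Tuple Rs = ∀ i → FiniteCommRing.Carrier (Rs i)

cons : ∀ {s} {Rs : Fin (suc s) → FiniteCommRing} →
       FiniteCommRing.Carrier (Rs zero) → Tuple (λ i → Rs (suc i)) → Tuple Rs
cons x g zero    = x
cons x g (suc i) = g i

tuples : ∀ {s} (Rs : Fin s → FiniteCommRing) → List (Tuple Rs)
tuples {zero}  Rs = (λ ()) ∷ []
tuples {suc s} Rs = concatMap (λ x → map (cons {Rs = Rs} x) (tuples (λ i → Rs (suc i)))) (FiniteCommRing.elems (Rs zero))

-- Distributivity of products over sums, needed to factor sums over R. The summand reads a tuple
-- only through its values, so `cons` computes and no equality between functions is involved.
∑-tuples : ∀ {s} (Rs : Fin s → FiniteCommRing) (h : ∀ i → FiniteCommRing.Carrier (Rs i) → ℚ) →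
           ∑[ g ← tuples Rs ] ∏ (λ i → h i (g i)) ≡ ∏ (λ i → ∑ (FiniteCommRing.elems (Rs i)) (h i))
∑-tuples {zero}  Rs h = refl
∑-tuples {suc s} Rs h = begin
  ∑[ g ← tuples Rs ] ∏ (λ i → h i (g i))
    ≡⟨ ∑-concatMap (FiniteCommRing.elems (Rs zero)) _ (λ g → ∏ (λ i → h i (g i))) ⟩
  ∑[ x ← FiniteCommRing.elems (Rs zero) ] ∑ (map (cons {Rs = Rs} x) rest) (λ g → ∏ (λ i → h i (g i)))
    ≡⟨ ∑-cong (FiniteCommRing.elems (Rs zero)) (λ x → trans (∑-map rest (cons {Rs = Rs} x) (λ g → ∏ (λ i → h i (g i))))
         (∑-*ˡ rest (h zero x) (λ g → ∏ (λ i → h (suc i) (g i))))) ⟩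
  ∑[ x ← FiniteCommRing.elems (Rs zero) ] (h zero x * ∑ rest (λ g → ∏ (λ i → h (suc i) (g i))))
    ≡⟨ ∑-*ʳ (FiniteCommRing.elems (Rs zero)) _ (h zero) ⟩
  ∑ (FiniteCommRing.elems (Rs zero)) (h zero) * ∑ rest (λ g → ∏ (λ i → h (suc i) (g i)))
    ≡⟨ cong (∑ (FiniteCommRing.elems (Rs zero)) (h zero) *_) (∑-tuples (λ i → Rs (suc i)) (λ i → h (suc i))) ⟩
  ∏ (λ i → ∑ (FiniteCommRing.elems (Rs i)) (h i)) ∎
  where
  open ≡-Reasoning
  rest = tuples (λ i → Rs (suc i))

module LocalEigenfunction (R : FiniteCommRing) (M : FiniteCommRing.Carrier R → Bool)
                          (M-ideal : FiniteCommRing.IsIdeal R M) where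
  open FiniteCommRing R
    renaming (_+_ to _⊕_; _*_ to _⊗_; _-_ to _⊖_; -_ to ∼_; refl to ≈-refl; sym to ≈-sym; trans to ≈-trans)
    hiding (zero; I)
  open RingSums R
  open Cosets R M M-ideal

  -- The indicator of M, shifted to have sum zero and scaled to integer values. The zero sum makes a
  -- sum over the complement of a coset equal to minus the sum over that coset.
  eigen : Carrier → ℚ
  eigen x = ι card * ind (M x) - ι size

  eigen-resp : Resp eigen
  eigen-resp p = cong (λ d → ι card * d - ι size) (ind-resp p)

  ∑-eigen : ∑ elems eigen ≡ 0ℚ
  ∑-eigen = begin
    ∑ elems eigen
      ≡⟨ ∑-sub elems (λ x → ι card * ind (M x)) (λ _ → ι size) ⟩
    ∑ elems (λ x → ι card * ind (M x)) - ∑ elems (λ _ → ι size)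
      ≡⟨ cong₂ _-_ (trans (∑-*ˡ elems (ι card) (λ x → ind (M x))) (cong (ι card *_) (sym (ι-countIn M))))
                   (trans (∑-cong elems (λ _ → sym (ℚₚ.*-identityˡ (ι size)))) (trans (∑-*ʳ elems (ι size) (λ _ → 1ℚ)) (cong (_* ι size) (sym ι-card)))) ⟩
    ι card * ι size - ι card * ι size
      ≡⟨ ℚₚ.+-inverseʳ (ι card * ι size) ⟩
    0ℚ ∎
    where open ≡-Reasoning

  -- The total sum vanishes, so what remains is minus the sum over the coset of u, where `eigen` is
  -- constant with value `eigen u`.
  eigen-sum : ∀ u → ∑[ v ← elems ] (ind (not (M (v ⊖ u))) * eigen v) ≡ - ι size * eigen u
  eigen-sum u = begin
    ∑[ v ← elems ] (ind (not (M (v ⊖ u))) * eigen v)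
      ≡⟨ ∑-cong elems (λ v → trans (cong (_* eigen v) (ind-not (M (v ⊖ u))))
           (trans (solve 2 (λ a b → (con 1ℚ :- a) :* b := b :- a :* b) refl (ind (M (v ⊖ u))) (eigen v))
             (cong (λ q → eigen v - q) (ind-*-cong (M (v ⊖ u)) (λ p → cong (λ b → ι card * ind b - ι size) (∈-≋ p)))))) ⟩
    ∑[ v ← elems ] (eigen v - ind (M (v ⊖ u)) * eigen u)
      ≡⟨ ∑-sub elems eigen (λ v → ind (M (v ⊖ u)) * eigen u) ⟩
    ∑ elems eigen - ∑ elems (λ v → ind (M (v ⊖ u)) * eigen u)
      ≡⟨ cong₂ _-_ ∑-eigen (trans (∑-*ʳ elems (eigen u) (λ v → ind (M (v ⊖ u)))) (cong (_* eigen u) (∑-coset u))) ⟩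
    0ℚ - ι size * eigen u
      ≡⟨ solve 2 (λ a b → con 0ℚ :- a :* b := :- a :* b) refl (ι size) (eigen u) ⟩
    - ι size * eigen u ∎
    where open ≡-Reasoning

  size≤card : size ℕ.≤ card
  size≤card = ι-cancel-≤ size card (subst₂ ℚ._≤_ (sym (ι-countIn M)) (sym ι-card) (∑-mono elems (λ x → ind≤1 (M x))))
    where
    ind≤1 : ∀ b → ind b ℚ.≤ 1ℚ
    ind≤1 true  = ℚₚ.≤-refl
    ind≤1 false = ℚₚ.<⇒≤ (ℚₚ.positive⁻¹ 1ℚ)

  cosize : ℕ
  cosize = card ℕ.∸ size

  ι-cosize : ι cosize ≡ ι card - ι size
  ι-cosize = trans (solve 2 (λ a b → a := (a :+ b) :- b) refl (ι cosize) (ι size))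
    (cong (_- ι size) (trans (sym (ι-+ cosize size)) (cong ι (ℕₚ.m∸n+n≡m size≤card))))

  degree-sum : ∀ u → ∑[ v ← elems ] ind (not (M (v ⊖ u))) ≡ ι cosize
  degree-sum u = begin
    ∑[ v ← elems ] ind (not (M (v ⊖ u)))      ≡⟨ ∑-cong elems (λ v → ind-not (M (v ⊖ u))) ⟩
    ∑[ v ← elems ] (1ℚ - ind (M (v ⊖ u)))     ≡⟨ ∑-sub elems (λ _ → 1ℚ) (λ v → ind (M (v ⊖ u))) ⟩
    ∑ elems (λ _ → 1ℚ) - ∑ elems (λ v → ind (M (v ⊖ u)))  ≡⟨ cong₂ _-_ (sym ι-card) (∑-coset u) ⟩
    ι card - ι size                           ≡⟨ ι-cosize ⟨
    ι cosize                                  ∎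
    where open ≡-Reasoning

  eigen-0 : eigen 0# ≡ ι cosize
  eigen-0 rewrite FiniteCommRing.IsIdeal.zero∈ M-ideal = trans (cong (_- ι size) (ℚₚ.*-identityʳ (ι card))) (sym ι-cosize)

-- The walk on lifts of an eigenfunction

module WalkEigenfunction (R : FiniteCommRing) where
  open FiniteCommRing R
    renaming (_+_ to _⊕_; _*_ to _⊗_; _-_ to _⊖_; -_ to ∼_; refl to ≈-refl; sym to ≈-sym; trans to ≈-trans)
    hiding (zero; I)
  open RingSums R
  open Walk R

  module _ (F : Carrier → ℚ) (F-resp : Resp F) (κ : ℚ)
           (F-eigen : ∀ x → ∑[ w ← elems ] (ind (adj w x) * F w) ≡ κ * F x)
           (deg≢0 : deg 0# ≢ 0) where

    -- Twice the eigenvalue κ/deg of the simple random walk; it is the trace of the step on the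
    -- coefficients of `lift`.
    θ : ℚ
    θ = 2ℚ * r * κ

    lift : ℚ → ℚ → ArcFunction
    lift a b (x , y) = a * F x + b * F y

    inflow-lift : ∀ a b x → inflow (lift a b) x ≡ (a * θ + b * 2ℚ) * F x
    inflow-lift a b x = begin
      2ℚ * r * (∑[ w ← elems ] (ind (adj w x) * (a * F w + b * F x)))
        ≡⟨ cong (2ℚ * r *_) (trans (∑-cong elems (λ w →
             solve 5 (λ i a f b g → i :* (a :* f :+ b :* g) := a :* (i :* f) :+ i :* (b :* g)) refl (ind (adj w x)) a (F w) b (F x)))
             (∑-+ elems (λ w → a * (ind (adj w x) * F w)) (λ w → ind (adj w x) * (b * F x)))) ⟩
      2ℚ * r * (∑ elems (λ w → a * (ind (adj w x) * F w)) + ∑ elems (λ w → ind (adj w x) * (b * F x)))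
        ≡⟨ cong₂ (λ s t → 2ℚ * r * (s + t))
             (trans (∑-*ˡ elems a (λ w → ind (adj w x) * F w)) (cong (a *_) (F-eigen x)))
             (trans (∑-*ʳ elems (b * F x) (λ w → ind (adj w x))) (cong (_* (b * F x)) degree)) ⟩
      2ℚ * r * (a * (κ * F x) + ι (deg 0#) * (b * F x))
        ≡⟨ solve 7 (λ t r a k f d b → t :* r :* (a :* (k :* f) :+ d :* (b :* f)) := (a :* (t :* r :* k) :+ (r :* d) :* (b :* t)) :* f) refl
             2ℚ r a κ (F x) (ι (deg 0#)) b ⟩
      (a * θ + r * ι (deg 0#) * (b * 2ℚ)) * F x
        ≡⟨ cong (λ s → (a * θ + s) * F x) (trans (cong (_* (b * 2ℚ)) (fracℚ-inverse R (deg 0#) deg≢0)) (ℚₚ.*-identityˡ (b * 2ℚ))) ⟩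
      (a * θ + b * 2ℚ) * F x ∎
      where
      open ≡-Reasoning
      degree : ∑[ w ← elems ] ind (adj w x) ≡ ι (deg 0#)
      degree = trans (∑-cong elems (λ w → cong ind (adj-sym w x))) (trans (sym (ι-deg x)) (cong ι (deg-regular x)))

    inflow-pointwise : ∀ {g h} → (∀ a → g a ≡ h a) → ∀ x → inflow g x ≡ inflow h x
    inflow-pointwise eq = inflow-cong (λ u v _ → eq (u , v))

    -- A step acts on the coefficients by (a , b) ↦ (θ a + b , -a), a matrix of trace θ and
    -- determinant 1, whose powers have Chebyshev entries. The start (0 , 1) becomes (1 , 0) after
    -- one step, which fixes the indexing.
    walk-lift : ∀ n a → walk (suc n) (lift 0ℚ 1ℚ) a ≡ lift (cheb θ (suc n)) (- cheb θ n) a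
    walk-lift zero (x , y) = trans (cong (_- lift 0ℚ 1ℚ (y , x)) (inflow-lift 0ℚ 1ℚ x))
      (solve 3 (λ t f g → (con 0ℚ :* t :+ con 1ℚ :* (con 1ℚ :+ con 1ℚ)) :* f :- (con 0ℚ :* g :+ con 1ℚ :* f)
                          := con 1ℚ :* f :+ (:- con 0ℚ) :* g) refl θ (F x) (F y))
    walk-lift (suc n) (x , y) = trans
      (cong₂ _-_ (trans (inflow-pointwise (walk-lift n) x) (inflow-lift (cheb θ (suc n)) (- cheb θ n) x)) (walk-lift n (y , x)))
      (solve 5 (λ t a b f g → (a :* t :+ (:- b) :* (con 1ℚ :+ con 1ℚ)) :* f :- (a :* g :+ (:- b) :* f)
                              := (t :* a :- b) :* f :+ (:- a) :* g) refl θ (cheb θ (suc n)) (cheb θ n) (F x) (F y))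

    lift-resp : ∀ a b → Resp₂ (lift a b)
    lift-resp a b p q = cong₂ (λ s t → a * s + b * t) (F-resp p) (F-resp q)

    -- Coefficients cannot be compared on arcs directly, so the fixed-point equation and its
    -- reversal are each summed over the arcs into `0#`. With F 0# ≢ 0ℚ this gives αθ - 2β = 2 and
    -- 2α - βθ = θ; eliminating β leaves α (4 - θ²) = 0.
    periodic⇒cheb-root : F 0# ≢ 0ℚ → Periodic → ∃ λ n → cheb θ (suc n) * (4ℚ - θ * θ) ≡ 0ℚ
    periodic⇒cheb-root F0≢0 periodic@(suc n , _) = n , (begin
      α * (4ℚ - θ * θ)
        ≡⟨ solve 3 (λ t a b → a :* ((con 1ℚ :+ con 1ℚ) :* (con 1ℚ :+ con 1ℚ) :- t :* t)
             := (con 1ℚ :+ con 1ℚ) :* ((:- b) :* t :+ a :* (con 1ℚ :+ con 1ℚ) :- t) :- t :* (a :* t :+ (:- b) :* (con 1ℚ :+ con 1ℚ) :- (con 1ℚ :+ con 1ℚ))) refl θ α β ⟩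
      2ℚ * (- β * θ + α * 2ℚ - θ) - θ * (α * θ + - β * 2ℚ - 2ℚ)
        ≡⟨ cong₂ (λ s t → 2ℚ * s - θ * t) tail-equation head-equation ⟩
      2ℚ * 0ℚ - θ * 0ℚ
        ≡⟨ solve 2 (λ a t → a :* con 0ℚ :- t :* con 0ℚ := con 0ℚ) refl 2ℚ θ ⟩
      0ℚ ∎)
      where
      open ≡-Reasoning
      α = cheb θ (suc n)
      β = cheb θ n
      fixed : lift α (- β) ≗ᵃ lift 0ℚ 1ℚ
      fixed x y p = trans (sym (walk-lift n (x , y))) (periodic⇒ periodic (lift 0ℚ 1ℚ) (lift-resp 0ℚ 1ℚ) x y p)
      fixed-reversed : lift (- β) α ≗ᵃ lift 1ℚ 0ℚ
      fixed-reversed x y p = trans (ℚₚ.+-comm (- β * F x) (α * F y))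
        (trans (fixed y x (trans (adj-sym y x) p)) (ℚₚ.+-comm (0ℚ * F y) (1ℚ * F x)))
      cancel : ∀ p q → p * F 0# ≡ q * F 0# → p - q ≡ 0ℚ
      cancel p q e = *-cancelˡ-≡0 (F 0#) F0≢0 (begin
        F 0# * (p - q)           ≡⟨ solve 3 (λ f p q → f :* (p :- q) := p :* f :- q :* f) refl (F 0#) p q ⟩
        p * F 0# - q * F 0#      ≡⟨ cong (_- q * F 0#) e ⟩
        q * F 0# - q * F 0#      ≡⟨ ℚₚ.+-inverseʳ (q * F 0#) ⟩
        0ℚ                       ∎)
      compare : ∀ a b a′ b′ → lift a b ≗ᵃ lift a′ b′ → a * θ + b * 2ℚ - (a′ * θ + b′ * 2ℚ) ≡ 0ℚ
      compare a b a′ b′ eq =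
        cancel (a * θ + b * 2ℚ) (a′ * θ + b′ * 2ℚ) (trans (sym (inflow-lift a b 0#)) (trans (inflow-cong eq 0#) (inflow-lift a′ b′ 0#)))
      head-equation : α * θ + - β * 2ℚ - 2ℚ ≡ 0ℚ
      head-equation = trans (cong (λ q → α * θ + - β * 2ℚ - q) (solve 2 (λ s t → s := con 0ℚ :* t :+ con 1ℚ :* s) refl 2ℚ θ)) (compare α (- β) 0ℚ 1ℚ fixed)
      tail-equation : - β * θ + α * 2ℚ - θ ≡ 0ℚ
      tail-equation = trans (cong (λ q → - β * θ + α * 2ℚ - q) (solve 2 (λ s t → t := con 1ℚ :* t :+ con 0ℚ :* s) refl 2ℚ θ)) (compare (- β) α 1ℚ 0ℚ fixed-reversed)

module ProductEigenfunction
  (R : FiniteCommRing) {s : ℕ} (Rs : Fin s → FiniteCommRing)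
  (Ms : (i : Fin s) → FiniteCommRing.Carrier (Rs i) → Bool)
  (Ms-unique : ∀ i → FiniteCommRing.IsUniqueMaximalIdeal (Rs i) (Ms i))
  (iso : ProductIso R Rs) where
  open FiniteCommRing R
    renaming (_+_ to _⊕_; _*_ to _⊗_; _-_ to _⊖_; -_ to ∼_; refl to ≈-refl; sym to ≈-sym; trans to ≈-trans)
    hiding (zero; I)
  open RingSums R
  open Walk R
  open LocalProduct R Rs Ms Ms-unique iso
  module E (i : Fin s) = LocalEigenfunction (Rs i) (Ms i) (L.ideal i)

  -- φ is bijective only up to ≈. Each factor is therefore expanded as a Kronecker sum; after the
  -- exchange of sums, every tuple is hit by exactly one class of R, given by `surj` and `inj`.
  fubini : ∀ (h : ∀ i → FiniteCommRing.Carrier (Rs i) → ℚ) → (∀ i → L.Resp i (h i)) →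
           ∑[ v ← elems ] ∏ (λ i → h i (φ v i)) ≡ ∏ (λ i → ∑ (L.elems i) (h i))
  fubini h h-resp = begin
    ∑[ v ← elems ] ∏ (λ i → h i (φ v i))
      ≡⟨ ∑-cong elems (λ v → trans (∏-cong (λ i → sym (L.kronecker i (φ v i) (h i) (h-resp i))))
           (sym (∑-tuples Rs (λ i y → ind (does (L._≟_ i (φ v i) y)) * h i y)))) ⟩
    ∑[ v ← elems ] (∑[ g ← tuples Rs ] ∏ (λ i → ind (does (L._≟_ i (φ v i) (g i))) * h i (g i)))
      ≡⟨ ∑-swap elems (tuples Rs) (λ v g → ∏ (λ i → ind (does (L._≟_ i (φ v i) (g i))) * h i (g i))) ⟩
    ∑[ g ← tuples Rs ] (∑[ v ← elems ] ∏ (λ i → ind (does (L._≟_ i (φ v i) (g i))) * h i (g i)))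
      ≡⟨ ∑-cong (tuples Rs) (λ g → trans
           (∑-cong elems (λ v → trans (∏-* (λ i → ind (does (L._≟_ i (φ v i) (g i)))) (λ i → h i (g i)))
             (cong (_* ∏ (λ i → h i (g i))) (indicator g v))))
           (kronecker (proj₁ (surj g)) (λ _ → ∏ (λ i → h i (g i))) (λ _ → refl))) ⟩
    ∑[ g ← tuples Rs ] ∏ (λ i → h i (g i))
      ≡⟨ ∑-tuples Rs h ⟩
    ∏ (λ i → ∑ (L.elems i) (h i)) ∎
    where
    open ≡-Reasoning
    indicator : ∀ g v → ∏ (λ i → ind (does (L._≟_ i (φ v i) (g i)))) ≡ ind (does (proj₁ (surj g) ≟ v))
    indicator g v = trans (∏-ind (λ i → does (L._≟_ i (φ v i) (g i)))) (cong ind (⇔→≡ (mk⇔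
      (λ p → does-true (≈-sym (inj v (proj₁ (surj g)) λ i →
        L.≈-trans i (L.does-sound i (allᵇ⁻ (λ i → does (L._≟_ i (φ v i) (g i))) p i)) (L.≈-sym i (proj₂ (surj g) i)))))
      (λ p → allᵇ⁺ (λ i → does (L._≟_ i (φ v i) (g i))) λ i →
        L.does-true i (L.≈-trans i (φ-cong (≈-sym (does-sound p)) i) (proj₂ (surj g) i))))))

  -- Units of a product are tuples of units, so G_R is the tensor product of the graphs of its
  -- factors. This is why local eigenfunctions and eigenvalues multiply.
  ind-adj : ∀ w x → ind (adj w x) ≡ ∏ (λ i → ind (not (Ms i (L._⊖_ i (φ w i) (φ x i)))))
  ind-adj w x = trans (cong ind (⇔→≡ (mk⇔
      (λ p → allᵇ⁺ _ (λ i → cong not (adj⇒∉ w x p i)))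
      (λ p → ∉⇒adj w x (λ i → not-true (allᵇ⁻ _ p i))))))
    (sym (∏-ind (λ i → not (Ms i (L._⊖_ i (φ w i) (φ x i))))))
    where
    not-true : ∀ {b} → not b ≡ true → b ≡ false
    not-true {false} _ = refl

  F : Carrier → ℚ
  F x = ∏ (λ i → E.eigen i (φ x i))

  F-resp : Resp F
  F-resp p = ∏-cong (λ i → E.eigen-resp i (φ-cong p i))

  κ : ℚ
  κ = ∏ (λ i → - ι (L.size i))

  nonunit-resp : ∀ i u → L.Resp i (λ v → ind (not (Ms i (L._⊖_ i v u))))
  nonunit-resp i u p = cong (λ b → ind (not b)) (L.resp i (L.⊖-cong i p (L.≈-refl i)))

  F-eigen : ∀ x → ∑[ w ← elems ] (ind (adj w x) * F w) ≡ κ * F x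
  F-eigen x = begin
    ∑[ w ← elems ] (ind (adj w x) * F w)
      ≡⟨ ∑-cong elems (λ w → trans (cong (_* F w) (ind-adj w x)) (sym (∏-* _ (λ i → E.eigen i (φ w i))))) ⟩
    ∑[ w ← elems ] ∏ (λ i → ind (not (Ms i (L._⊖_ i (φ w i) (φ x i)))) * E.eigen i (φ w i))
      ≡⟨ fubini (λ i v → ind (not (Ms i (L._⊖_ i v (φ x i)))) * E.eigen i v)
           (λ i p → cong₂ _*_ (nonunit-resp i (φ x i) p) (E.eigen-resp i p)) ⟩
    ∏ (λ i → ∑ (L.elems i) (λ v → ind (not (Ms i (L._⊖_ i v (φ x i)))) * E.eigen i v))
      ≡⟨ trans (∏-cong (λ i → E.eigen-sum i (φ x i))) (∏-* (λ i → - ι (L.size i)) (λ i → E.eigen i (φ x i))) ⟩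
    κ * F x ∎
    where open ≡-Reasoning

  sizes cosizes : ℕ
  sizes   = ∏ℕ (λ i → L.size i)
  cosizes = ∏ℕ (λ i → E.cosize i)

  ι-deg-0 : ι (deg 0#) ≡ ι cosizes
  ι-deg-0 = begin
    ι (deg 0#)
      ≡⟨ trans (ι-deg 0#) (∑-cong elems (λ w → trans (cong ind (adj-sym 0# w)) (ind-adj w 0#))) ⟩
    ∑[ w ← elems ] ∏ (λ i → ind (not (Ms i (L._⊖_ i (φ w i) (φ 0# i)))))
      ≡⟨ fubini (λ i v → ind (not (Ms i (L._⊖_ i v (φ 0# i))))) (λ i → nonunit-resp i (φ 0# i)) ⟩
    ∏ (λ i → ∑ (L.elems i) (λ v → ind (not (Ms i (L._⊖_ i v (φ 0# i))))))
      ≡⟨ trans (∏-cong (λ i → E.degree-sum i (φ 0# i))) (∏-ι (λ i → E.cosize i)) ⟩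
    ι cosizes ∎
    where open ≡-Reasoning

  F-0 : F 0# ≡ ι cosizes
  F-0 = trans (∏-cong (λ i → trans (E.eigen-resp i (φ-0 i)) (E.eigen-0 i))) (∏-ι (λ i → E.cosize i))

  periodic⇒bound : cosizes ≢ 0 → sizes ≢ 0 → Periodic → cosizes ℕ.≤ 2 ℕ.* sizes
  periodic⇒bound cosizes≢0 sizes≢0 periodic =
    cheb-root-bound {θ} {sign s} (2 ℕ.* sizes) cosizes 2sizes≢0 (integral-sign s) (sign² s) θN≡εA (proj₁ root) (proj₂ root)
    where
    open ≡-Reasoning
    deg≢0 : deg 0# ≢ 0
    deg≢0 e = ι≢0 cosizes cosizes≢0 (trans (sym ι-deg-0) (cong ι e))
    open WalkEigenfunction R using (periodic⇒cheb-root)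
    θ = WalkEigenfunction.θ R F F-resp κ F-eigen deg≢0
    root = periodic⇒cheb-root F F-resp κ F-eigen deg≢0 (λ e → ι≢0 cosizes cosizes≢0 (trans (sym F-0) e)) periodic
    2sizes≢0 : 2 ℕ.* sizes ≢ 0
    2sizes≢0 e with ℕₚ.m*n≡0⇒m≡0∨n≡0 2 e
    ... | inj₂ e′ = sizes≢0 e′
    θN≡εA : θ * ι cosizes ≡ sign s * ι (2 ℕ.* sizes)
    θN≡εA = begin
      2ℚ * r * κ * ι cosizes
        ≡⟨ solve 4 (λ t r k n → t :* r :* k :* n := (r :* n) :* (t :* k)) refl 2ℚ r κ (ι cosizes) ⟩
      r * ι cosizes * (2ℚ * κ)
        ≡⟨ cong (_* (2ℚ * κ)) (trans (cong (r *_) (sym ι-deg-0)) (fracℚ-inverse R (deg 0#) deg≢0)) ⟩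
      1ℚ * (2ℚ * κ)
        ≡⟨ cong (λ k → 1ℚ * (2ℚ * k)) (trans (∏-neg (λ i → ι (L.size i))) (cong (sign s *_) (∏-ι (λ i → L.size i)))) ⟩
      1ℚ * (2ℚ * (sign s * ι sizes))
        ≡⟨ solve 3 (λ t e m → con 1ℚ :* (t :* (e :* m)) := e :* (t :* m)) refl 2ℚ (sign s) (ι sizes) ⟩
      sign s * (2ℚ * ι sizes)
        ≡⟨ cong (sign s *_) (ι-* 2 sizes) ⟨
      sign s * ι (2 ℕ.* sizes) ∎

-- Residue fields with few elements

module Classification (R : FiniteCommRing) (M : FiniteCommRing.Carrier R → Bool)
                      (M-unique : FiniteCommRing.IsUniqueMaximalIdeal R M) where
  open Local R M M-unique
  open import Algebra.Properties.Semiring.Mult semiring using (×1-homo-*; ×-homo-+) renaming (_×_ to _·1×_)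
  private module E = LocalEigenfunction R M ideal

  ∑-cosets : ∀ as → ∑[ a ← as ] (∑[ v ← elems ] ind (M (v ⊖ a))) ≡ ι (length as ℕ.* size)
  ∑-cosets []       = refl
  ∑-cosets (a ∷ as) = trans (cong₂ _+_ (∑-coset a) (∑-cosets as)) (sym (ι-+ size (length as ℕ.* size)))

  -- Counting the pairs (v , a) with v ≋ a in two ways: each a contributes a full coset, and each v
  -- occurs at most once because the listed cosets differ.
  cosets-disjoint : ∀ as → AllPairs (λ a b → ¬ a ≋ b) as → length as ℕ.* size ℕ.≤ card
  cosets-disjoint as disjoint = ι-cancel-≤ _ _ (subst₂ ℚ._≤_
    (trans (∑-swap elems as (λ v a → ind (M (v ⊖ a)))) (∑-cosets as)) (sym ι-card)
    (∑-mono elems (λ v → at-most-one v as disjoint)))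
    where
    none : ∀ v as → All (λ a → ¬ v ≋ a) as → ∑[ a ← as ] ind (M (v ⊖ a)) ≡ 0ℚ
    none v []       []       = refl
    none v (a ∷ as) (p ∷ ps) rewrite ¬-not p = trans (ℚₚ.+-identityˡ _) (none v as ps)
    at-most-one : ∀ v as → AllPairs (λ a b → ¬ a ≋ b) as → ∑[ a ← as ] ind (M (v ⊖ a)) ℚ.≤ 1ℚ
    at-most-one v []       []       = ℚₚ.<⇒≤ (ℚₚ.positive⁻¹ 1ℚ)
    at-most-one v (a ∷ as) (p ∷ ps) with M (v ⊖ a) in eq
    ... | true  = ℚₚ.≤-reflexive (cong (1ℚ +_) (none v as (All.map (λ a≋̸b v≋b → a≋̸b (≋-trans (≋-sym eq) v≋b)) p)))
    ... | false = ℚₚ.≤-trans (ℚₚ.≤-reflexive (ℚₚ.+-identityˡ _)) (at-most-one v as ps)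
    
  cosets-cover : ∀ as → (∀ v → Any (v ≋_) as) → card ℕ.≤ length as ℕ.* size
  cosets-cover as cover = ι-cancel-≤ _ _ (subst₂ ℚ._≤_
    (sym ι-card) (trans (∑-swap elems as (λ v a → ind (M (v ⊖ a)))) (∑-cosets as))
    (∑-mono elems (λ v → at-least-one v as (cover v))))
    where
    0≤ind : ∀ b → 0ℚ ℚ.≤ ind b
    0≤ind true  = ℚₚ.<⇒≤ (ℚₚ.positive⁻¹ 1ℚ)
    0≤ind false = ℚₚ.≤-refl
    nonneg : ∀ v as → 0ℚ ℚ.≤ ∑[ a ← as ] ind (M (v ⊖ a))
    nonneg v as = ℚₚ.≤-trans (ℚₚ.≤-reflexive (sym (∑-zero as))) (∑-mono as (λ a → 0≤ind (M (v ⊖ a))))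
    at-least-one : ∀ v as → Any (v ≋_) as → 1ℚ ℚ.≤ ∑[ a ← as ] ind (M (v ⊖ a))
    at-least-one v (a ∷ as) (here p)  rewrite p =
      ℚₚ.≤-trans (ℚₚ.≤-reflexive (sym (ℚₚ.+-identityʳ 1ℚ))) (ℚₚ.+-monoʳ-≤ 1ℚ (nonneg v as))
    at-least-one v (a ∷ as) (there p) =
      ℚₚ.≤-trans (ℚₚ.≤-reflexive (sym (ℚₚ.+-identityˡ 1ℚ))) (ℚₚ.+-mono-≤ (0≤ind (M (v ⊖ a))) (at-least-one v as p))

  search : (P : Carrier → Bool) → (∀ {x y} → x ≈ y → P x ≡ P y) → (∀ x → P x ≡ true) ⊎ (∃ λ x → P x ≡ false)
  search P P-resp with Any.any? (λ x → P x Bool.≟ false) elems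
  ... | yes p = inj₂ (Any.satisfied p)
  ... | no ¬p = inj₁ λ x → ¬-not λ Px≡false →
    ¬p (Any.map (λ x≈y → trans (sym (P-resp x≈y)) Px≡false) (complete x))

  ρ : ℕ → Carrier
  ρ n = n ·1× 1#

  module _ (m : ℕ) .{{_ : ℕ.NonZero m}} (ρ-m : ρ m ≋ 0#)
           (ρ-injective : ∀ a b → a ℕ.< m → b ℕ.< m → ρ a ≋ ρ b → a ≡ b)
           (representative : ∀ x → ∃ λ a → a ℕ.< m × x ≋ ρ a) where

    private
      rep : Carrier → ℕ
      rep x = proj₁ (representative x)

      rep<m : ∀ x → rep x ℕ.< m
      rep<m x = proj₁ (proj₂ (representative x))

      ≋ρ-rep : ∀ x → x ≋ ρ (rep x)
      ≋ρ-rep x = proj₂ (proj₂ (representative x))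

      ρ-% : ∀ n → ρ n ≋ ρ (n ℕ.% m)
      ρ-% n = ≋-trans (≈⇒≋ (≈-trans (reflexive (cong ρ (m≡m%n+[m/n]*n n m)))
          (≈-trans (×-homo-+ 1# (n ℕ.% m) (n ℕ./ m ℕ.* m)) (+-cong ≈-refl (×1-homo-* (n ℕ./ m) m)))))
        (≋-trans (≋-+ ≋-refl (≋-trans (≋-*ˡ (ρ (n ℕ./ m)) ρ-m) (≈⇒≋ (zeroʳ (ρ (n ℕ./ m)))))) (≈⇒≋ (+-identityʳ (ρ (n ℕ.% m)))))

      rep-unique : ∀ x n → x ≋ ρ n → rep x ≡ n ℕ.% m
      rep-unique x n p = ρ-injective (rep x) (n ℕ.% m) (rep<m x) (m%n<n n m) (≋-trans (≋-sym (≋ρ-rep x)) (≋-trans p (ρ-% n)))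

    -- The isomorphism is the inverse of n ↦ n · 1, which the hypotheses make bijective from {0,
    -- ..., m - 1} onto the cosets. Each homomorphism law then follows from uniqueness of the
    -- representative modulo m.
    residue-iso : ResidueIso M m
    residue-iso = record
      { f       = rep
      ; f<m     = rep<m
      ; classes = λ x y → mk⇔
          (λ e → ≋-trans (≋ρ-rep x) (≋-trans (≈⇒≋ (reflexive (cong ρ e))) (≋-sym (≋ρ-rep y))))
          (λ p → ρ-injective (rep x) (rep y) (rep<m x) (rep<m y) (≋-trans (≋-sym (≋ρ-rep x)) (≋-trans p (≋ρ-rep y))))
      ; surj    = λ k k<m → ρ k , ρ-injective (rep (ρ k)) k (rep<m (ρ k)) k<m (≋-sym (≋ρ-rep (ρ k)))
      ; hom-+   = λ x y → rep-unique (x ⊕ y) (rep x ℕ.+ rep y)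
          (≋-trans (≋-+ (≋ρ-rep x) (≋ρ-rep y)) (≈⇒≋ (≈-sym (×-homo-+ 1# (rep x) (rep y)))))
      ; hom-*   = λ x y → rep-unique (x ⊗ y) (rep x ℕ.* rep y)
          (≋-trans (≋-* (≋ρ-rep x) (≋ρ-rep y)) (≈⇒≋ (≈-sym (×1-homo-* (rep x) (rep y)))))
      ; hom-1   = rep-unique 1# 1 (≈⇒≋ (≈-sym (+-identityʳ 1#)))
      }

  ρ1 : ρ 1 ≈ 1#
  ρ1 = +-identityʳ 1#

  ρ2 : ρ 2 ≈ 1# ⊕ 1#
  ρ2 = +-cong ≈-refl ρ1

  0≋̸1 : ¬ 0# ≋ 1#
  0≋̸1 p = 1∉ (≋0⇒∈ (≋-sym p))

  ∨-false : ∀ {a b} → a ∨ b ≡ false → a ≡ false × b ≡ false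
  ∨-false {false} e = refl , e

  ∨-true : ∀ {a b} → a ∨ b ≡ true → a ≡ true ⊎ b ≡ true
  ∨-true {true}  e = inj₁ refl
  ∨-true {false} e = inj₂ e

  ∉⇒≋̸0 : ∀ {x} → M x ≡ false → ¬ 0# ≋ x
  ∉⇒≋̸0 p q = ∉⇒¬∈ p (≋0⇒∈ (≋-sym q))

  0≋̸-1 : ¬ 0# ≋ ∼ 1#
  0≋̸-1 p = ∉⇒¬∈ (≋-1⇒∉ ≋-refl) (≋0⇒∈ (≋-sym p))

  1≋̸-1 : M (1# ⊕ 1#) ≡ false → ¬ 1# ≋ ∼ 1#
  1≋̸-1 2∉ p = ∉⇒¬∈ 2∉ (trans (sym (resp (x⊖-y≈x⊕y 1# 1#))) p)

  cancelʳ : ∀ c {a b} → a ⊕ c ≋ b ⊕ c → a ≋ b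
  cancelʳ c {a} {b} p = ≋-trans (≈⇒≋ (≈-sym (x⊕y⊖y≈x a c))) (≋-trans (≋-⊖ p ≋-refl) (≈⇒≋ (x⊕y⊖y≈x b c)))

  -- No larger field needs to be identified: four cosets already force `cosize` to be at least three
  -- times `size`, too much for the bound.
  Classified : Set
  Classified = (ResidueIso M 2 × card ≡ 2 ℕ.* size) ⊎ (ResidueIso M 3 × card ≡ 3 ℕ.* size) ⊎ 4 ℕ.* size ℕ.≤ card

  -- With 2 in M, the classes 0 and 1 are closed under addition. A class x outside them brings its
  -- translate x + 1 along, so a third coset forces a fourth.
  classify-even : M (1# ⊕ 1#) ≡ true → Classified
  classify-even 2∈ with search (λ x → M x ∨ M (x ⊖ 1#)) (λ e → cong₂ _∨_ (resp e) (resp (⊖-cong e ≈-refl)))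
  ... | inj₁ all = inj₁ (residue-iso 2 (≋-trans (≈⇒≋ ρ2) (∈⇒≋0 2∈)) injective representative
                        , ℕₚ.≤-antisym (cosets-cover (0# ∷ 1# ∷ []) cover) (cosets-disjoint (0# ∷ 1# ∷ []) ((0≋̸1 ∷ []) ∷ [] ∷ [])))
    where
    injective : ∀ a b → a ℕ.< 2 → b ℕ.< 2 → ρ a ≋ ρ b → a ≡ b
    injective 0 0 _ _ _ = refl
    injective 1 1 _ _ _ = refl
    injective 0 1 _ _ p = contradiction (≋-trans p (≈⇒≋ ρ1)) 0≋̸1
    injective 1 0 _ _ p = contradiction (≋-trans (≋-sym p) (≈⇒≋ ρ1)) 0≋̸1
    injective (suc (suc _)) _ (s≤s (s≤s ())) _ _
    injective _ (suc (suc _)) _ (s≤s (s≤s ())) _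
    representative : ∀ x → ∃ λ a → a ℕ.< 2 × x ≋ ρ a
    representative x with ∨-true {M x} (all x)
    ... | inj₁ p = 0 , s≤s z≤n , ∈⇒≋0 p
    ... | inj₂ p = 1 , s≤s (s≤s z≤n) , ≋-trans p (≈⇒≋ (≈-sym ρ1))
    cover : ∀ x → Any (x ≋_) (0# ∷ 1# ∷ [])
    cover x with ∨-true {M x} (all x)
    ... | inj₁ p = here (∈⇒≋0 p)
    ... | inj₂ p = there (here p)
  ... | inj₂ (x , e) = inj₂ (inj₂ (cosets-disjoint (0# ∷ 1# ∷ x ∷ x ⊕ 1# ∷ [])
      -- For 0 against x ⊕ 1#: replacing 0 by 1 + 1, which lies in M, allows 1 to be cancelled and
      -- yields x ≋ 1.
      ( (0≋̸1 ∷ ∉⇒≋̸0 x∉ ∷ (λ p → x≋̸1 (cancelʳ 1# (≋-trans (≋-sym p) (≋-sym (∈⇒≋0 2∈))))) ∷ [])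
      ∷ ((λ p → x≋̸1 (≋-sym p)) ∷ (λ p → ∉⇒≋̸0 x∉ (cancelʳ 1# (≋-trans (≈⇒≋ (+-identityˡ 1#)) p))) ∷ [])
      ∷ ((λ p → 0≋̸1 (cancelʳ x (≋-trans (≈⇒≋ (+-identityˡ x)) (≋-trans p (≈⇒≋ (+-comm x 1#)))))) ∷ [])
      ∷ [] ∷ [])))
    where
    x∉ = proj₁ (∨-false {M x} e)
    x≋̸1 = ∉⇒¬∈ (proj₂ (∨-false {M x} e))

  -- With 2 outside M, the classes 0, 1 and -1 are distinct. Either they are all the classes, or any
  -- further x supplies a fourth.
  classify-odd : M (1# ⊕ 1#) ≡ false → Classified
  classify-odd 2∉ with search (λ x → M x ∨ (M (x ⊖ 1#) ∨ M (x ⊕ 1#)))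
                     (λ e → cong₂ _∨_ (resp e) (cong₂ _∨_ (resp (⊖-cong e ≈-refl)) (resp (+-cong e ≈-refl))))
  ... | inj₁ all = inj₂ (inj₁ (residue-iso 3 ρ3≋0 injective representative
                        , ℕₚ.≤-antisym (cosets-cover (0# ∷ 1# ∷ ∼ 1# ∷ []) cover)
                            (cosets-disjoint (0# ∷ 1# ∷ ∼ 1# ∷ []) ((0≋̸1 ∷ 0≋̸-1 ∷ []) ∷ (1≋̸-1 2∉ ∷ []) ∷ [] ∷ []))))
    where
    trichotomy : ∀ x → x ≋ 0# ⊎ x ≋ 1# ⊎ x ≋ ∼ 1#
    trichotomy x with ∨-true {M x} (all x)
    ... | inj₁ p = inj₁ (∈⇒≋0 p)
    ... | inj₂ q with ∨-true {M (x ⊖ 1#)} q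
    ...   | inj₁ p = inj₂ (inj₁ p)
    ...   | inj₂ p = inj₂ (inj₂ (trans (resp (x⊖-y≈x⊕y x 1#)) p))
    -- Of the three available classes, 2 is not 0 by assumption and not 1 by cancellation. This
    -- yields characteristic three without any structure theory of fields.
    2≋-1 : 1# ⊕ 1# ≋ ∼ 1#
    2≋-1 with trichotomy (1# ⊕ 1#)
    ... | inj₁ p        = contradiction (≋0⇒∈ p) (∉⇒¬∈ 2∉)
    ... | inj₂ (inj₁ p) = contradiction (cancelʳ 1# (≋-trans (≈⇒≋ (+-identityˡ 1#)) (≋-sym p))) 0≋̸1
    ... | inj₂ (inj₂ p) = p
    ρ3≋0 : ρ 3 ≋ 0#
    ρ3≋0 = ≋-trans (≋-+ (≋-refl {1#}) (≋-trans (≈⇒≋ ρ2) 2≋-1)) (≈⇒≋ (-‿inverseʳ 1#))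
    0≋̸ρ2 : ¬ 0# ≋ ρ 2
    0≋̸ρ2 p = ∉⇒¬∈ 2∉ (≋0⇒∈ (≋-sym (≋-trans p (≈⇒≋ ρ2))))
    ρ1≋̸ρ2 : ¬ ρ 1 ≋ ρ 2
    ρ1≋̸ρ2 p = 0≋̸1 (cancelʳ 1# (≋-trans (≈⇒≋ (≈-trans (+-identityˡ 1#) (≈-sym ρ1))) (≋-trans p (≈⇒≋ ρ2))))
    injective : ∀ a b → a ℕ.< 3 → b ℕ.< 3 → ρ a ≋ ρ b → a ≡ b
    injective 0 0 _ _ _ = refl
    injective 1 1 _ _ _ = refl
    injective 2 2 _ _ _ = refl
    injective 0 1 _ _ p = contradiction (≋-trans p (≈⇒≋ ρ1)) 0≋̸1
    injective 1 0 _ _ p = contradiction (≋-trans (≋-sym p) (≈⇒≋ ρ1)) 0≋̸1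
    injective 0 2 _ _ p = contradiction p 0≋̸ρ2
    injective 2 0 _ _ p = contradiction (≋-sym p) 0≋̸ρ2
    injective 1 2 _ _ p = contradiction p ρ1≋̸ρ2
    injective 2 1 _ _ p = contradiction (≋-sym p) ρ1≋̸ρ2
    injective (suc (suc (suc _))) _ (s≤s (s≤s (s≤s ()))) _ _
    injective _ (suc (suc (suc _))) _ (s≤s (s≤s (s≤s ()))) _
    representative : ∀ x → ∃ λ a → a ℕ.< 3 × x ≋ ρ a
    representative x with trichotomy x
    ... | inj₁ p        = 0 , s≤s z≤n , p
    ... | inj₂ (inj₁ p) = 1 , s≤s (s≤s z≤n) , ≋-trans p (≈⇒≋ (≈-sym ρ1))
    ... | inj₂ (inj₂ p) = 2 , s≤s (s≤s (s≤s z≤n)) , ≋-trans p (≋-trans (≋-sym 2≋-1) (≈⇒≋ (≈-sym ρ2)))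
    cover : ∀ x → Any (x ≋_) (0# ∷ 1# ∷ ∼ 1# ∷ [])
    cover x with trichotomy x
    ... | inj₁ p        = here p
    ... | inj₂ (inj₁ p) = there (here p)
    ... | inj₂ (inj₂ p) = there (there (here p))
  ... | inj₂ (x , e) = inj₂ (inj₂ (cosets-disjoint (0# ∷ 1# ∷ ∼ 1# ∷ x ∷ [])
      ( (0≋̸1 ∷ 0≋̸-1 ∷ ∉⇒≋̸0 x∉ ∷ [])
      ∷ (1≋̸-1 2∉ ∷ (λ p → ∉⇒¬∈ (proj₁ x∉±1) (≋-sym p)) ∷ [])
      ∷ ((λ p → ∉⇒¬∈ (proj₂ x∉±1) (trans (sym (resp (x⊖-y≈x⊕y x 1#))) (≋-sym p))) ∷ [])
      ∷ [] ∷ [])))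
    where
    x∉ = proj₁ (∨-false {M x} e)
    x∉±1 = ∨-false {M (x ⊖ 1#)} (proj₂ (∨-false {M x} e))

  classify : Classified
  classify with M (1# ⊕ 1#) in eq
  ... | true  = classify-even eq
  ... | false = classify-odd eq

  residueSize≡ : ∀ c → card ≡ c ℕ.* size → residueSize M ≡ c
  residueSize≡ c e with countIn M | size≢0
  ... | zero  | 0≢0 = contradiction refl 0≢0
  ... | suc m | _   = trans (cong (ℕ._/ suc m) e) (m*n/n≡m c (suc m))

  cosize≡ : ∀ c → card ≡ suc c ℕ.* size → E.cosize ≡ c ℕ.* size
  cosize≡ c e = trans (cong (ℕ._∸ size) e) (ℕₚ.m+n∸m≡n size (c ℕ.* size))

  cosize≥ : ∀ c → suc c ℕ.* size ℕ.≤ card → c ℕ.* size ℕ.≤ E.cosize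
  cosize≥ c le = subst (ℕ._≤ E.cosize) (ℕₚ.m+n∸m≡n size (c ℕ.* size)) (ℕₚ.∸-monoˡ-≤ size le)

-- From the product bound to the residue fields

∏ℕ-mono : ∀ {s} {f g : Fin s → ℕ} → (∀ i → f i ℕ.≤ g i) → ∏ℕ f ℕ.≤ ∏ℕ g
∏ℕ-mono {zero}  h = ℕₚ.≤-refl
∏ℕ-mono {suc s} h = ℕₚ.*-mono-≤ (h zero) (∏ℕ-mono (λ i → h (suc i)))

∏ℕ≢0 : ∀ {s} {f : Fin s → ℕ} → (∀ i → f i ≢ 0) → ∏ℕ f ≢ 0
∏ℕ≢0 {zero}  h ()
∏ℕ≢0 {suc s} {f} h e with ℕₚ.m*n≡0⇒m≡0∨n≡0 (f zero) e
... | inj₁ p = h zero p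
... | inj₂ p = ∏ℕ≢0 (λ i → h (suc i)) p

∏ℕ-scale : ∀ {s} {f g : Fin s → ℕ} c j → (∀ i → f i ℕ.≤ g i) → c ℕ.* f j ℕ.≤ g j → c ℕ.* ∏ℕ f ℕ.≤ ∏ℕ g
∏ℕ-scale {f = f} {g} c zero h le =
  subst (ℕ._≤ ∏ℕ g) (ℕₚ.*-assoc c (f zero) _) (ℕₚ.*-mono-≤ le (∏ℕ-mono (λ i → h (suc i))))
∏ℕ-scale {f = f} {g} c (suc j) h le =
  subst (ℕ._≤ ∏ℕ g) (swap c (f zero) _) (ℕₚ.*-mono-≤ (h zero) (∏ℕ-scale c j (λ i → h (suc i)) le))
  where
  swap : ∀ c a b → a ℕ.* (c ℕ.* b) ≡ c ℕ.* (a ℕ.* b)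
  swap = solve-∀

module Converse
  (R : FiniteCommRing) (k : ℕ) (Rs : Fin (suc k) → FiniteCommRing)
  (Ms : (i : Fin (suc k)) → FiniteCommRing.Carrier (Rs i) → Bool)
  (Ms-unique : ∀ i → FiniteCommRing.IsUniqueMaximalIdeal (Rs i) (Ms i))
  (iso : ProductIso R Rs)
  (ordered : ∀ i j → toℕ i ℕ.≤ toℕ j →
     FiniteCommRing.residueSize (Rs j) (Ms j) ℕ.≤ FiniteCommRing.residueSize (Rs i) (Ms i))
  (periodic : FiniteCommRing.Periodic R) where
  open ProductEigenfunction R Rs Ms Ms-unique iso
  open LocalProduct R Rs Ms Ms-unique iso using (module L)
  module K (i : Fin (suc k)) = Classification (Rs i) (Ms i) (Ms-unique i)

  size≤cosize : ∀ i → L.size i ℕ.≤ E.cosize i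
  size≤cosize i with K.classify i
  ... | inj₁ (_ , e)        = ℕₚ.≤-reflexive (sym (trans (K.cosize≡ i 1 e) (ℕₚ.*-identityˡ _)))
  ... | inj₂ (inj₁ (_ , e)) = subst (L.size i ℕ.≤_) (sym (K.cosize≡ i 2 e)) (ℕₚ.m≤n*m (L.size i) 2)
  ... | inj₂ (inj₂ le)      = ℕₚ.≤-trans (ℕₚ.m≤n*m (L.size i) 3) (K.cosize≥ i 3 le)

  sizes≢0 : sizes ≢ 0
  sizes≢0 = ∏ℕ≢0 (λ i → L.size≢0 i)

  cosizes≢0 : cosizes ≢ 0
  cosizes≢0 = ∏ℕ≢0 {f = E.cosize} λ i e → L.size≢0 i (ℕₚ.n≤0⇒n≡0 (subst (L.size i ℕ.≤_) e (size≤cosize i)))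

  bound : cosizes ℕ.≤ 2 ℕ.* sizes
  bound = periodic⇒bound cosizes≢0 sizes≢0 periodic

  factor≤2 : ∀ c → 2 ℕ.< c → ¬ c ℕ.* sizes ℕ.≤ cosizes
  factor≤2 c 2<c le = ℕₚ.<⇒≱ 2<c (ℕₚ.*-cancelʳ-≤ c 2 sizes {{ℕ.≢-nonZero sizes≢0}} (ℕₚ.≤-trans le bound))

  small : ∀ i → (FiniteCommRing.ResidueIso (Rs i) (Ms i) 2 × L.card i ≡ 2 ℕ.* L.size i) ⊎ (FiniteCommRing.ResidueIso (Rs i) (Ms i) 3 × L.card i ≡ 3 ℕ.* L.size i)
  small i with K.classify i
  ... | inj₁ two          = inj₁ two
  ... | inj₂ (inj₁ three) = inj₂ three
  -- A factor with at least four cosets contributes 3 and all others at least 1, so the product is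
  -- at least 3 · `sizes`, above the bound.
  ... | inj₂ (inj₂ four)  = contradiction (∏ℕ-scale 3 i size≤cosize (K.cosize≥ i 3 four)) (factor≤2 3 ℕₚ.≤-refl)

  -- If a later factor had residue field of order 3, the ordering would exclude order 2 for the
  -- first factor, leaving order 3 there too. Two such factors contribute 2 · 2 = 4, above the bound
  -- of 2.
  rest-two : ∀ i → FiniteCommRing.ResidueIso (Rs (suc i)) (Ms (suc i)) 2
  rest-two i with small (suc i)
  ... | inj₁ (two , _) = two
  ... | inj₂ (_ , e) with small zero
  ...   | inj₁ (_ , e₀) = contradiction
    (subst₂ ℕ._≤_ (K.residueSize≡ (suc i) 3 e) (K.residueSize≡ zero 2 e₀) (ordered zero (suc i) z≤n)) λ { (s≤s (s≤s ())) }
  ...   | inj₂ (_ , e₀) = contradiction four (factor≤2 4 (s≤s (s≤s (s≤s z≤n))))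
    where
    twice : ∀ j → L.card j ≡ 3 ℕ.* L.size j → 2 ℕ.* L.size j ℕ.≤ E.cosize j
    twice j e = ℕₚ.≤-reflexive (sym (K.cosize≡ j 2 e))
    regroup : ∀ a b → 2 ℕ.* a ℕ.* (2 ℕ.* b) ≡ 4 ℕ.* (a ℕ.* b)
    regroup = solve-∀
    four : 4 ℕ.* sizes ℕ.≤ cosizes
    four = subst (ℕ._≤ cosizes) (regroup (L.size zero) _)
      (ℕₚ.*-mono-≤ (twice zero e₀) (∏ℕ-scale 2 i (λ i → size≤cosize (suc i)) (twice (suc i) e)))

  first : FiniteCommRing.ResidueIso (Rs zero) (Ms zero) 2 ⊎ FiniteCommRing.ResidueIso (Rs zero) (Ms zero) 3
  first with small zero
  ... | inj₁ (two , _)   = inj₁ two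
  ... | inj₂ (three , _) = inj₂ three

theorem4p3 : (R : FiniteCommRing) (k : ℕ)
    (Rs : Fin (suc k) → FiniteCommRing)
    (Ms : (i : Fin (suc k)) → FiniteCommRing.Carrier (Rs i) → Bool)
    → (∀ i → FiniteCommRing.IsUniqueMaximalIdeal (Rs i) (Ms i))
    → ProductIso R Rs
    → (∀ i j → toℕ i ≤ toℕ j →
    FiniteCommRing.residueSize (Rs j) (Ms j) ≤ FiniteCommRing.residueSize (Rs i) (Ms i))
    → FiniteCommRing.Periodic R
    ⇔ ((FiniteCommRing.ResidueIso (Rs zero) (Ms zero) 2
    ⊎ FiniteCommRing.ResidueIso (Rs zero) (Ms zero) 3)
    × (∀ (i : Fin k) → FiniteCommRing.ResidueIso (Rs (suc i)) (Ms (suc i)) 2))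
theorem4p3 R k Rs Ms Ms-unique iso ordered = mk⇔
  (λ periodic → let open Converse R k Rs Ms Ms-unique iso ordered periodic in first , rest-two)
  λ { (inj₁ two , twos)   → two-periodic (λ { zero → L.iso₂⇒two zero two ; (suc i) → L.iso₂⇒two (suc i) (twos i) })
    ; (inj₂ three , twos) → three-periodic zero (L.iso₃⇒three zero three)
        (λ { zero 0≢0 → contradiction refl 0≢0 ; (suc i) _ → L.iso₂⇒two (suc i) (twos i) }) }
  where open LocalProduct R Rs Ms Ms-unique iso
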